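{- If $\tau\in\{1001,1011,1101\}$, then $$f_\tau(x)=\frac{1-3x+3x^2-\sqrt{(1-3x+x^2)^2-4x^3(1-x)}}{2x^2}$$ as formal power series in $x$, where $f_\tau(x)=\sum_{n\ge 0} b_n(\tau)x^n$ and $b_n(\tau)$ is the number of ascent sequences of length $n$ that avoid both patterns $021$ and $\tau$.
   Context: For a finite sequence $w=w_1\cdots w_n$ of integers, $\mathrm{asc}(w)$ is the number of indices $1\le i\le n-1$ with $w_i<w_{i+1}$. An ascent sequence of length $n\ge 1$ is a sequence $a_1\cdots a_n$ of non-negative integers such that $a_1=0$ and $a_i\le \mathrm{asc}(a_1\cdots a_{i-1})+1$ for $1<i\le n$; there is exactly one (empty) ascent sequence of length $0$. A sequence $\pi=\pi_1\cdots\pi_n$ contains a pattern $\tau=\tau_1\cdots\tau_m$ if there are indices $1\le i_1<\cdots<i_m\le n$ such that for all $j,k\in\{1,\dots,m\}$: $\pi_{i_j}<\pi_{i_k}$ iff $\tau_j<\tau_k$, and $\pi_{i_j}=\pi_{i_k}$ iff $\tau_j=\tau_k$; otherwise $\pi$ avoids $\tau$. For a pattern $\tau$, $B_n(\tau)$ is the set of ascent sequences of length $n$ avoiding both $021$ and $\tau$ (with $B_0(\tau)$ consisting of the empty sequence), and $b_n(\tau)=|B_n(\tau)|$. The square root denotes the formal power series square root with constant term $1$. -}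

module Defs where

open import Data.Bool.Base using (true; false; if_then_else_)
open import Data.Empty using (⊥-elim)
open import Data.Fin.Base as Fin using (Fin; toℕ)
import Data.Fin.Properties as Fin
open import Data.Integer.Base as ℤ using (ℤ; +_; 0ℤ; 1ℤ)
import Data.Integer.Properties as ℤ
open import Data.Integer.Solver using (module +-*-Solver)
open import Data.List.Base
  using (List; []; _∷_; length; lookup; take; upTo; filter; cartesianProductWith)
open import Data.List.Properties using (∷-injective; length-take)
open import Data.List.Membership.Propositional using (_∈_)
open import Data.List.Membership.Propositional.Properties
  using (∈-cartesianProductWith⁺; ∈-upTo⁺; ∈-filter⁺; ∈-filter⁻)
open import Data.List.Relation.Unary.Any using (here)
open import Data.List.Relation.Unary.AllPairs using ([]; _∷_)
import Data.List.Relation.Unary.All as All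
open import Data.List.Relation.Unary.Unique.Propositional using (Unique)
import Data.List.Relation.Unary.Unique.Propositional.Properties as Unique
open import Data.Nat.Base as ℕ using (ℕ; zero; suc; _∸_; _<_; _≤_; z≤n; s≤s)
import Data.Nat.Properties as ℕ
open import Data.Product.Base using (∃; _×_; _,_; proj₁; proj₂)
open import Data.Sum.Base using (inj₁; inj₂)
open import Data.Vec.Base as Vec using (Vec; []; _∷_)
open import Function.Base using (_∘_)
open import Function.Bundles using (_⇔_; mk⇔; module Equivalence)
open import Relation.Binary.PropositionalEquality
  using (_≡_; _≢_; refl; sym; trans; cong; cong₂; subst; module ≡-Reasoning)
open import Relation.Nullary using (¬_; Dec)
open import Relation.Nullary.Decidable using (map′; _×-dec_; _→-dec_; ¬?)
open import Relation.Unary using (Pred; Decidable)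
open import Level using (0ℓ)

open import Algebra.Properties.Monoid.Sum ℤ.+-0-monoid using (sum-syntax)

------------------------------------------------------------------------
-- Ascent sequences

asc : List ℕ → ℕ
asc []           = 0
asc (_ ∷ [])     = 0
asc (x ∷ y ∷ ys) = (if x ℕ.<ᵇ y then 1 else 0) ℕ.+ asc (y ∷ ys)

-- Positions are numbered from 0, so the entries strictly before position i
-- are `take (toℕ i) w`.
IsAscentSequence : Pred (List ℕ) 0ℓ
IsAscentSequence w = (i : Fin (length w)) →
  (toℕ i ≡ 0 → lookup w i ≡ 0) ×
  (0 < toℕ i → lookup w i ≤ asc (take (toℕ i) w) ℕ.+ 1)

------------------------------------------------------------------------
-- Pattern containment

IsOccurrence : (π τ : List ℕ) → Pred (Vec (Fin (length π)) (length τ)) 0ℓ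
IsOccurrence π τ ι =
  (∀ j k → j Fin.< k → Vec.lookup ι j Fin.< Vec.lookup ι k) ×
  (∀ j k →
    (lookup π (Vec.lookup ι j) < lookup π (Vec.lookup ι k) ⇔ lookup τ j < lookup τ k) ×
    (lookup π (Vec.lookup ι j) ≡ lookup π (Vec.lookup ι k) ⇔ lookup τ j ≡ lookup τ k))

_Contains_ : List ℕ → List ℕ → Set
π Contains τ = ∃ (IsOccurrence π τ)

_Avoids_ : List ℕ → List ℕ → Set
π Avoids τ = ¬ (π Contains τ)

B : List ℕ → ℕ → Pred (List ℕ) 0ℓ
B τ n w =
  length w ≡ n × IsAscentSequence w × w Avoids (0 ∷ 2 ∷ 1 ∷ []) × w Avoids τ

------------------------------------------------------------------------
-- Decidability

_⇔-dec_ : ∀ {P Q : Set} → Dec P → Dec Q → Dec (P ⇔ Q)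
p? ⇔-dec q? =
  map′ (λ (f , g) → mk⇔ f g)
       (λ e → Equivalence.to e , Equivalence.from e)
       ((p? →-dec q?) ×-dec (q? →-dec p?))

anyVec? : ∀ {n} m {P : Pred (Vec (Fin n) m) 0ℓ} → Decidable P → Dec (∃ P)
anyVec? zero    P? = map′ ([] ,_) (λ { ([] , p) → p }) (P? [])
anyVec? (suc m) P? =
  map′ (λ (i , is , p) → i ∷ is , p)
       (λ { (i ∷ is , p) → i , is , p })
       (Fin.any? λ i → anyVec? m λ is → P? (i ∷ is))

isAscentSequence? : Decidable IsAscentSequence
isAscentSequence? w = Fin.all? λ i →
  ((toℕ i ℕ.≟ 0) →-dec (lookup w i ℕ.≟ 0)) ×-dec
  ((0 ℕ.<? toℕ i) →-dec (lookup w i ℕ.≤? asc (take (toℕ i) w) ℕ.+ 1))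

isOccurrence? : ∀ π τ → Decidable (IsOccurrence π τ)
isOccurrence? π τ ι =
  (Fin.all? λ j → Fin.all? λ k →
    (j Fin.<? k) →-dec (Vec.lookup ι j Fin.<? Vec.lookup ι k)) ×-dec
  (Fin.all? λ j → Fin.all? λ k →
    ((lookup π (Vec.lookup ι j) ℕ.<? lookup π (Vec.lookup ι k))
      ⇔-dec (lookup τ j ℕ.<? lookup τ k)) ×-dec
    ((lookup π (Vec.lookup ι j) ℕ.≟ lookup π (Vec.lookup ι k))
      ⇔-dec (lookup τ j ℕ.≟ lookup τ k)))

contains? : ∀ π τ → Dec (π Contains τ)
contains? π τ = anyVec? (length τ) (isOccurrence? π τ)

B? : ∀ τ n → Decidable (B τ n)
B? τ n w =
  (length w ℕ.≟ n) ×-dec isAscentSequence? w ×-dec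
  ¬? (contains? w (0 ∷ 2 ∷ 1 ∷ [])) ×-dec ¬? (contains? w τ)

------------------------------------------------------------------------
-- Counting

-- All words of length n over the alphabet {0, …, k-1}.
words : ℕ → ℕ → List (List ℕ)
words k zero    = [] ∷ []
words k (suc n) = cartesianProductWith _∷_ (upTo k) (words k n)

-- Every entry of an ascent sequence of length n is smaller than n, so nothing
-- is lost by searching `words n n`; see `elements-complete`.
elements : List ℕ → ℕ → List (List ℕ)
elements τ n = filter (B? τ n) (words n n)

b : List ℕ → ℕ → ℕ
b τ n = length (elements τ n)

words-unique : ∀ k n → Unique (words k n)
words-unique k zero    = All.[] ∷ []
words-unique k (suc n) =
  Unique.cartesianProductWith⁺ _∷_ ∷-injective (Unique.upTo⁺ k) (words-unique k n)

words-complete : ∀ k w → (∀ i → lookup w i < k) → w ∈ words k (length w)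
words-complete k []      _ = here refl
words-complete k (x ∷ w) h =
  ∈-cartesianProductWith⁺ _∷_ (∈-upTo⁺ (h Fin.zero)) (words-complete k w (h ∘ Fin.suc))

asc-bound : ∀ x w → asc (x ∷ w) ≤ length w
asc-bound x []      = z≤n
asc-bound x (y ∷ w) with x ℕ.<ᵇ y
... | true  = s≤s (asc-bound y w)
... | false = ℕ.m≤n⇒m≤1+n (asc-bound y w)

take-asc-bound : ∀ k w → asc (take (suc k) w) ≤ k
take-asc-bound k []      = z≤n
take-asc-bound k (x ∷ w) = ℕ.≤-trans (asc-bound x (take k w))
  (subst (_≤ k) (sym (length-take k w)) (ℕ.m⊓n≤m k (length w)))

entry-bound : ∀ w → IsAscentSequence w → ∀ i → lookup w i ≤ toℕ i
entry-bound w h i with toℕ i | h i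
... | zero  | (p , _) = ℕ.≤-reflexive (p refl)
... | suc k | (_ , q) = ℕ.≤-trans (q (s≤s z≤n))
  (subst (_≤ suc k) (ℕ.+-comm 1 _) (s≤s (take-asc-bound k w)))

elements-unique : ∀ τ n → Unique (elements τ n)
elements-unique τ n = Unique.filter⁺ (B? τ n) (words-unique n n)

elements-sound : ∀ τ n {w} → w ∈ elements τ n → B τ n w
elements-sound τ n = proj₂ ∘ ∈-filter⁻ (B? τ n) {xs = words n n}

elements-complete : ∀ τ n {w} → B τ n w → w ∈ elements τ n
elements-complete τ n {w} p@(refl , isAsc , _) = ∈-filter⁺ (B? τ n)
  (words-complete n w λ i → ℕ.≤-<-trans (entry-bound w isAsc i) (Fin.toℕ<n i)) p

------------------------------------------------------------------------
-- Formal power series over ℤ, as coefficient sequences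

PowerSeries : Set
PowerSeries = ℕ → ℤ

infix  4 _≈_
infixl 6 _⊕_ _⊖_
infixl 7 _⊛_
infixr 8 _·_
infixr 9 _⊛^_

_≈_ : PowerSeries → PowerSeries → Set
F ≈ G = ∀ n → F n ≡ G n

_⊕_ _⊖_ _⊛_ : PowerSeries → PowerSeries → PowerSeries
(F ⊕ G) n = F n ℤ.+ G n
(F ⊖ G) n = F n ℤ.- G n
(F ⊛ G) n = ∑[ i < suc n ] (F (toℕ i) ℤ.* G (n ∸ toℕ i))

_·_ : ℕ → PowerSeries → PowerSeries
(c · F) n = + c ℤ.* F n

𝟏 X : PowerSeries
𝟏 zero    = 1ℤ
𝟏 (suc _) = 0ℤ

X 1 = 1ℤ
X _ = 0ℤ

_⊛^_ : PowerSeries → ℕ → PowerSeries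
F ⊛^ zero  = 𝟏
F ⊛^ suc n = F ⊛ F ⊛^ n

-- S is the square root of D with constant term 1; `sqrt-unique` justifies
-- the definite article.
_IsSqrtOf_ : PowerSeries → PowerSeries → Set
S IsSqrtOf D = S 0 ≡ 1ℤ × S ⊛ S ≈ D

f : List ℕ → PowerSeries
f τ n = + b τ n

------------------------------------------------------------------------
-- Uniqueness of square roots

private
  shift : PowerSeries → PowerSeries
  shift F n = F (suc n)

  open +-*-Solver

  ⊛-sucʳ : ∀ F G n → (F ⊛ G) (suc n) ≡ (F ⊛ shift G) n ℤ.+ F (suc n) ℤ.* G 0
  ⊛-sucʳ F G zero    =
    solve 2 (λ a c → a :+ (c :+ con 0ℤ) := (a :+ con 0ℤ) :+ c) refl
      (F 0 ℤ.* G 1) (F 1 ℤ.* G 0)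
  ⊛-sucʳ F G (suc n) = trans
    (cong (ℤ._+_ (F 0 ℤ.* G (suc (suc n)))) (⊛-sucʳ (shift F) G n))
    (sym (ℤ.+-assoc (F 0 ℤ.* G (suc (suc n))) ((shift F ⊛ shift G) n) _))

  ⊛-comm : ∀ F G → F ⊛ G ≈ G ⊛ F
  ⊛-comm F G zero    = cong (ℤ._+ 0ℤ) (ℤ.*-comm (F 0) (G 0))
  ⊛-comm F G (suc n) = begin
    F 0 ℤ.* G (suc n) ℤ.+ (shift F ⊛ G) n
      ≡⟨ cong₂ ℤ._+_ (ℤ.*-comm (F 0) (G (suc n))) (⊛-comm (shift F) G n) ⟩
    G (suc n) ℤ.* F 0 ℤ.+ (G ⊛ shift F) n
      ≡⟨ ℤ.+-comm (G (suc n) ℤ.* F 0) _ ⟩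
    (G ⊛ shift F) n ℤ.+ G (suc n) ℤ.* F 0
      ≡⟨ ⊛-sucʳ G F n ⟨
    (G ⊛ F) (suc n) ∎
    where open ≡-Reasoning

  ⊛-expand : ∀ F G H K n → ((F ⊖ G) ⊛ (H ⊕ K)) n ≡
    ((F ⊛ H) n ℤ.+ (F ⊛ K) n) ℤ.- ((G ⊛ H) n ℤ.+ (G ⊛ K) n)
  ⊛-expand F G H K zero    =
    solve 4 (λ p q r s → (p :- q) :* (r :+ s) :+ con 0ℤ :=
      ((p :* r :+ con 0ℤ) :+ (p :* s :+ con 0ℤ)) :-
      ((q :* r :+ con 0ℤ) :+ (q :* s :+ con 0ℤ))) refl
      (F 0) (G 0) (H 0) (K 0)
  ⊛-expand F G H K (suc n) = trans
    (cong (ℤ._+_ ((F 0 ℤ.- G 0) ℤ.* (H (suc n) ℤ.+ K (suc n))))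
      (⊛-expand (shift F) (shift G) H K n))
    (solve 8 (λ p q r s t u v w →
      (p :- q) :* (r :+ s) :+ ((t :+ u) :- (v :+ w)) :=
      ((p :* r :+ t) :+ (p :* s :+ u)) :- ((q :* r :+ v) :+ (q :* s :+ w))) refl
      (F 0) (G 0) (H (suc n)) (K (suc n))
      ((shift F ⊛ H) n) ((shift F ⊛ K) n) ((shift G ⊛ H) n) ((shift G ⊛ K) n))

  ⊛-cancel : ∀ F G → G 0 ≢ 0ℤ → (∀ n → (F ⊛ G) n ≡ 0ℤ) → ∀ n → F n ≡ 0ℤ
  ⊛-cancel F G G₀≢0 h zero
    with ℤ.i*j≡0⇒i≡0∨j≡0 (F 0) (trans (sym (ℤ.+-identityʳ _)) (h 0))
  ... | inj₁ F₀≡0 = F₀≡0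
  ... | inj₂ G₀≡0 = ⊥-elim (G₀≢0 G₀≡0)
  ⊛-cancel F G G₀≢0 h (suc n) = ⊛-cancel (shift F) G G₀≢0 h′ n
    where
    h′ : ∀ m → (shift F ⊛ G) m ≡ 0ℤ
    h′ m = trans (sym (ℤ.+-identityˡ _)) (trans
      (cong (λ z → z ℤ.* G (suc m) ℤ.+ (shift F ⊛ G) m)
        (sym (⊛-cancel F G G₀≢0 h zero)))
      (h (suc m)))

sqrt-unique : ∀ {S T D} → S IsSqrtOf D → T IsSqrtOf D → S ≈ T
sqrt-unique {S} {T} {D} (S₀ , S²) (T₀ , T²) n =
  ℤ.i-j≡0⇒i≡j (S n) (T n) (⊛-cancel (S ⊖ T) (S ⊕ T) nonzero product n)
  where
  nonzero : (S ⊕ T) 0 ≢ 0ℤ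
  nonzero eq with trans (sym (cong₂ ℤ._+_ S₀ T₀)) eq
  ... | ()

  product : ∀ m → ((S ⊖ T) ⊛ (S ⊕ T)) m ≡ 0ℤ
  product m = begin
    ((S ⊖ T) ⊛ (S ⊕ T)) m
      ≡⟨ ⊛-expand S T S T m ⟩
    ((S ⊛ S) m ℤ.+ (S ⊛ T) m) ℤ.- ((T ⊛ S) m ℤ.+ (T ⊛ T) m)
      ≡⟨ cong₂ ℤ._-_ (cong₂ ℤ._+_ (S² m) (⊛-comm S T m))
                     (cong (ℤ._+_ ((T ⊛ S) m)) (T² m)) ⟩
    (D m ℤ.+ (T ⊛ S) m) ℤ.- ((T ⊛ S) m ℤ.+ D m)
      ≡⟨ solve 2 (λ d e → (d :+ e) :- (e :+ d) := con 0ℤ) refl (D m) ((T ⊛ S) m) ⟩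
    0ℤ ∎
    where open ≡-Reasoning

{-# OPTIONS --safe #-}
module Submission where

-- After the initial 0, a 021-avoiding ascent sequence is a word of zeros and weakly increasing
-- positive letters.  Cut it into blocks at the first occurrence of each positive letter m.  A block
-- avoiding τ contains at most one ascent 0 m, so it raises the slack d = asc − m by at most one, and
-- for all three τ the blocks raising it are enumerated by x³/(1−x)³ and the others by x/(1−x)²; the
-- next new letter then moves the slack to any value in {0, …, d}.  If U d enumerates the
-- continuations from slack d after a block that admits no further m, the differences
-- U (d + 1) − U d therefore satisfy a linear recurrence in d, which forces
-- U (d + 1) = (1 − x) U 0 U d.  Putting d = 0 gives a quadratic equation for U 0 = (f − 1) / x.

open import Defs
open import Algebra.Bundles using (CommutativeRing)
import Algebra.Solver.Ring
open import Algebra.Solver.Ring.AlmostCommutativeRing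
  using (AlmostCommutativeRing; fromCommutativeRing; _-Raw-AlmostCommutative⟶_)
open import Data.Bool.Base using (T; true; false; if_then_else_)
open import Data.Empty using (⊥-elim)
open import Data.Fin.Base as Fin using (Fin; toℕ)
open import Data.Fin.Patterns using (0F; 1F; 2F; 3F)
open import Data.Integer.Base as ℤ using (ℤ; +_; 0ℤ; 1ℤ)
import Data.Integer.Properties as ℤ
import Data.Integer.Solver
open import Data.List.Base
  using (List; []; _∷_; _++_; length; lookup; take; map; reverse; _ʳ++_; applyUpTo; filter; cartesianProductWith)
open import Data.List.Membership.Propositional using (_∈_)
open import Data.List.Properties using (filter-++; length-++)
open import Data.List.Relation.Binary.Sublist.Propositional
  using (_⊆_; []; _∷_; _∷ʳ_; ⊆-trans; minimum)
open import Data.List.Relation.Binary.Sublist.Propositional.Properties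
  using (∷ˡ⁻; reverse⁺; reverse⁻)
open import Data.List.Relation.Unary.Any using (here; there)
open import Data.Maybe.Base using (Maybe; just; nothing; is-just)
open import Data.Maybe using (to-witness-T)
open import Data.Nat.Base as ℕ using (ℕ; zero; suc; _+_; _<_; _≤_; s≤s; z≤n; _∸_)
import Data.Nat.Properties as ℕ
open import Data.Product.Base using (∃; _×_; _,_; proj₁; proj₂)
open import Data.Sum.Base using (inj₁; inj₂)
open import Data.Unit.Base using (⊤; tt)
open import Data.Vec.Base as Vec using (Vec; []; _∷_)
open import Data.Vec.N-ary using (N-ary; _$ⁿ_)
import Data.Vec.Properties as Vec
open import Function.Base using (_∘_; id)
open import Function.Bundles using (_⇔_; mk⇔; module Equivalence)
open import Level using (0ℓ)
open import Relation.Binary.Definitions using (tri<; tri≈; tri>)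
open import Relation.Binary.PropositionalEquality
  using (_≡_; _≢_; refl; sym; trans; cong; cong₂; subst; module ≡-Reasoning)
open import Relation.Binary.Structures using (IsEquivalence)
open import Relation.Nullary using (¬_; yes; no)
open import Relation.Unary using (Pred; Decidable)

open Data.Integer.Solver.+-*-Solver using (solve; _:=_; _:+_; _:*_; _:-_; con)

-- The ring of formal power series

tail : PowerSeries → PowerSeries
tail F n = F (suc n)

const : ℤ → PowerSeries
const c zero    = c
const c (suc _) = 0ℤ

const-0 : ∀ n → const 0ℤ n ≡ 0ℤ
const-0 zero    = refl
const-0 (suc _) = refl

⊝_ : PowerSeries → PowerSeries
(⊝ F) n = ℤ.- F n

infixr 8 _•_

_•_ : ℤ → PowerSeries → PowerSeries
(c • F) n = c ℤ.* F n

⊛-cong : ∀ {F F′ G G′} → F ≈ F′ → G ≈ G′ → F ⊛ G ≈ F′ ⊛ G′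
⊛-cong p q zero    = cong₂ (λ a b → a ℤ.* b ℤ.+ 0ℤ) (p 0) (q 0)
⊛-cong p q (suc n) = cong₂ ℤ._+_
  (cong₂ ℤ._*_ (p 0) (q (suc n))) (⊛-cong (λ i → p (suc i)) q n)

⊛-congʳ : ∀ G {F F′} → F ≈ F′ → F ⊛ G ≈ F′ ⊛ G
⊛-congʳ G p = ⊛-cong {G = G} {G} p (λ _ → refl)

⊛-sucʳ : ∀ F G n → (F ⊛ G) (suc n) ≡ (F ⊛ tail G) n ℤ.+ F (suc n) ℤ.* G 0
⊛-sucʳ F G zero    =
  solve 2 (λ a c → a :+ (c :+ con 0ℤ) := (a :+ con 0ℤ) :+ c) refl
    (F 0 ℤ.* G 1) (F 1 ℤ.* G 0)
⊛-sucʳ F G (suc n) = trans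
  (cong (ℤ._+_ (F 0 ℤ.* G (suc (suc n)))) (⊛-sucʳ (tail F) G n))
  (sym (ℤ.+-assoc (F 0 ℤ.* G (suc (suc n))) ((tail F ⊛ tail G) n) _))

⊛-comm : ∀ F G → F ⊛ G ≈ G ⊛ F
⊛-comm F G zero    = cong (ℤ._+ 0ℤ) (ℤ.*-comm (F 0) (G 0))
⊛-comm F G (suc n) = begin
  F 0 ℤ.* G (suc n) ℤ.+ (tail F ⊛ G) n
    ≡⟨ cong₂ ℤ._+_ (ℤ.*-comm (F 0) (G (suc n))) (⊛-comm (tail F) G n) ⟩
  G (suc n) ℤ.* F 0 ℤ.+ (G ⊛ tail F) n
    ≡⟨ ℤ.+-comm (G (suc n) ℤ.* F 0) _ ⟩
  (G ⊛ tail F) n ℤ.+ G (suc n) ℤ.* F 0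
    ≡⟨ ⊛-sucʳ G F n ⟨
  (G ⊛ F) (suc n) ∎
  where open ≡-Reasoning

⊛-distribʳ : ∀ H F G → (F ⊕ G) ⊛ H ≈ (F ⊛ H) ⊕ (G ⊛ H)
⊛-distribʳ H F G zero    =
  solve 3 (λ f g h → (f :+ g) :* h :+ con 0ℤ := (f :* h :+ con 0ℤ) :+ (g :* h :+ con 0ℤ))
    refl (F 0) (G 0) (H 0)
⊛-distribʳ H F G (suc n) = trans
  (cong (ℤ._+_ ((F 0 ℤ.+ G 0) ℤ.* H (suc n))) (⊛-distribʳ H (tail F) (tail G) n))
  (solve 5 (λ f g h u v → (f :+ g) :* h :+ (u :+ v) := (f :* h :+ u) :+ (g :* h :+ v))
    refl (F 0) (G 0) (H (suc n)) ((tail F ⊛ H) n) ((tail G ⊛ H) n))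

•-⊛-assoc : ∀ c F G → (c • F) ⊛ G ≈ c • (F ⊛ G)
•-⊛-assoc c F G zero    =
  solve 3 (λ c f g → c :* f :* g :+ con 0ℤ := c :* (f :* g :+ con 0ℤ)) refl c (F 0) (G 0)
•-⊛-assoc c F G (suc n) = trans
  (cong (ℤ._+_ (c ℤ.* F 0 ℤ.* G (suc n))) (•-⊛-assoc c (tail F) G n))
  (solve 4 (λ c f g u → c :* f :* g :+ c :* u := c :* (f :* g :+ u)) refl
    c (F 0) (G (suc n)) ((tail F ⊛ G) n))

-- tail (F ⊛ G) is definitionally (F 0 • tail G) ⊕ (tail F ⊛ G).
⊛-assoc : ∀ F G H → (F ⊛ G) ⊛ H ≈ F ⊛ (G ⊛ H)
⊛-assoc F G H zero    =
  solve 3 (λ f g h → (f :* g :+ con 0ℤ) :* h :+ con 0ℤ := f :* (g :* h :+ con 0ℤ) :+ con 0ℤ)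
    refl (F 0) (G 0) (H 0)
⊛-assoc F G H (suc n) = begin
  (F ⊛ G) 0 ℤ.* H (suc n) ℤ.+ (tail (F ⊛ G) ⊛ H) n
    ≡⟨ cong (ℤ._+_ ((F ⊛ G) 0 ℤ.* H (suc n))) (⊛-distribʳ H (F 0 • tail G) (tail F ⊛ G) n) ⟩
  (F ⊛ G) 0 ℤ.* H (suc n) ℤ.+ (((F 0 • tail G) ⊛ H) n ℤ.+ ((tail F ⊛ G) ⊛ H) n)
    ≡⟨ cong (ℤ._+_ ((F ⊛ G) 0 ℤ.* H (suc n)))
         (cong₂ ℤ._+_ (•-⊛-assoc (F 0) (tail G) H n) (⊛-assoc (tail F) G H n)) ⟩
  (F ⊛ G) 0 ℤ.* H (suc n) ℤ.+ (F 0 ℤ.* (tail G ⊛ H) n ℤ.+ (tail F ⊛ (G ⊛ H)) n)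
    ≡⟨ solve 5 (λ f g h u v →
         (f :* g :+ con 0ℤ) :* h :+ (f :* u :+ v) := f :* (g :* h :+ u) :+ v) refl
         (F 0) (G 0) (H (suc n)) ((tail G ⊛ H) n) ((tail F ⊛ (G ⊛ H)) n) ⟩
  F 0 ℤ.* (G ⊛ H) (suc n) ℤ.+ (tail F ⊛ (G ⊛ H)) n ∎
  where open ≡-Reasoning

⊛-zeroˡ : ∀ {F} → (∀ n → F n ≡ 0ℤ) → ∀ G n → (F ⊛ G) n ≡ 0ℤ
⊛-zeroˡ p G zero    = cong (λ a → a ℤ.* G 0 ℤ.+ 0ℤ) (p 0)
⊛-zeroˡ p G (suc n) = cong₂ ℤ._+_
  (cong (ℤ._* G (suc n)) (p 0)) (⊛-zeroˡ (λ i → p (suc i)) G n)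

const-⊛ : ∀ c F → const c ⊛ F ≈ c • F
const-⊛ c F zero    = ℤ.+-identityʳ _
const-⊛ c F (suc n) = trans
  (cong (ℤ._+_ (c ℤ.* F (suc n))) (⊛-zeroˡ (λ _ → refl) F n)) (ℤ.+-identityʳ _)

𝟏≈const1 : 𝟏 ≈ const 1ℤ
𝟏≈const1 zero    = refl
𝟏≈const1 (suc n) = refl

⊛-identityˡ : ∀ F → 𝟏 ⊛ F ≈ F
⊛-identityˡ F n = trans (⊛-congʳ F 𝟏≈const1 n)
  (trans (const-⊛ 1ℤ F n) (ℤ.*-identityˡ (F n)))

≈-isEquivalence : IsEquivalence _≈_
≈-isEquivalence = record
  { refl  = λ _ → refl
  ; sym   = λ p n → sym (p n)
  ; trans = λ p q n → trans (p n) (q n)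
  }

commutativeRing : CommutativeRing 0ℓ 0ℓ
commutativeRing = record
  { Carrier = PowerSeries
  ; _≈_ = _≈_
  ; _+_ = _⊕_
  ; _*_ = _⊛_
  ; -_  = ⊝_
  ; 0#  = const 0ℤ
  ; 1#  = 𝟏
  ; isCommutativeRing = record
    { isRing = record
      { +-isAbelianGroup = record
        { isGroup = record
          { isMonoid = record
            { isSemigroup = record
              { isMagma = record
                { isEquivalence = ≈-isEquivalence
                ; ∙-cong = λ p q n → cong₂ ℤ._+_ (p n) (q n)
                }
              ; assoc = λ F G H n → ℤ.+-assoc (F n) (G n) (H n)
              }
            ; identity = (λ F n → trans (cong (ℤ._+ F n) (const-0 n)) (ℤ.+-identityˡ (F n)))
                       , (λ F n → trans (cong (ℤ._+_ (F n)) (const-0 n)) (ℤ.+-identityʳ (F n)))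
            }
          ; inverse = (λ F n → trans (ℤ.+-inverseˡ (F n)) (sym (const-0 n)))
                    , (λ F n → trans (ℤ.+-inverseʳ (F n)) (sym (const-0 n)))
          ; ⁻¹-cong = λ p n → cong ℤ.-_ (p n)
          }
        ; comm = λ F G n → ℤ.+-comm (F n) (G n)
        }
      ; *-cong = ⊛-cong
      ; *-assoc = ⊛-assoc
      ; *-identity = ⊛-identityˡ , λ F n → trans (⊛-comm F 𝟏 n) (⊛-identityˡ F n)
      ; distrib = (λ H F G n → trans (⊛-comm H (F ⊕ G) n)
                    (trans (⊛-distribʳ H F G n) (cong₂ ℤ._+_ (⊛-comm F H n) (⊛-comm G H n))))
                , ⊛-distribʳ
      }
    ; *-comm = ⊛-comm
    }
  }

almostCommutativeRing : AlmostCommutativeRing 0ℓ 0ℓ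
almostCommutativeRing = fromCommutativeRing commutativeRing

constHomomorphism :
  CommutativeRing.rawRing ℤ.+-*-commutativeRing -Raw-AlmostCommutative⟶ almostCommutativeRing
constHomomorphism = record
  { ⟦_⟧    = const
  ; +-homo = λ { a b zero → refl ; a b (suc n) → refl }
  ; *-homo = λ { a b zero → sym (ℤ.+-identityʳ _)
               ; a b (suc n) → sym (trans (const-⊛ a (const b) (suc n)) (ℤ.*-zeroʳ a)) }
  ; -‿homo = λ { a zero → refl ; a (suc n) → refl }
  ; 0-homo = λ _ → refl
  ; 1-homo = λ n → sym (𝟏≈const1 n)
  }

const≟ : (a b : ℤ) → Maybe (const a ≈ const b)
const≟ a b with a ℤ.≟ b
... | yes refl = just (λ _ → refl)
... | no  _    = nothing

module PS = Algebra.Solver.Ring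
  (CommutativeRing.rawRing ℤ.+-*-commutativeRing) almostCommutativeRing constHomomorphism const≟

open PS using () renaming
  (_:+_ to _⊞_; _:*_ to _⊠_; _:-_ to _⊟_; :-_ to neg_; _:^_ to _⊠^_; _:=_ to _≐_; con to con′)

close : ∀ n {A : Set} → N-ary n (PS.Polynomial n) A → A
close n f = f $ⁿ Vec.map PS.var (Vec.allFin n)

-- Unlike `PS.solve`, this compares normal forms as data: unfolding the convolutions
-- of their values is prohibitively slow.
ring : ∀ n (e : N-ary n (PS.Polynomial n) (PS.Polynomial n × PS.Polynomial n)) →
  let (l , r) = close n e in
  {T (is-just (PS.normalise l PS.≟N PS.normalise r))} →
  (ρ : Vec PowerSeries n) → PS.⟦ l ⟧ ρ ≈ PS.⟦ r ⟧ ρ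
ring n e {t} ρ = let (l , r) = close n e in PS.prove ρ l r (PS.⟦ to-witness-T _ t ⟧N-cong ρ)

-- Zero series and equations

Zero : PowerSeries → Set
Zero F = ∀ n → F n ≡ 0ℤ

zero-⊕ : ∀ {F G} → Zero F → Zero G → Zero (F ⊕ G)
zero-⊕ p q n = cong₂ ℤ._+_ (p n) (q n)

zero-⊖ : ∀ {F G} → Zero F → Zero G → Zero (F ⊖ G)
zero-⊖ p q n = cong₂ ℤ._-_ (p n) (q n)

zero-⊛ : ∀ G {F} → Zero F → Zero (G ⊛ F)
zero-⊛ G {F} p n = trans (⊛-comm G F n) (⊛-zeroˡ p G n)

≈⇒zero : ∀ {F G} → F ≈ G → Zero (F ⊖ G)
≈⇒zero p n = ℤ.i≡j⇒i-j≡0 (p n)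

-- How linear algebra over series is done below: `ring` checks that the difference of the two sides
-- is a combination `H` of series already known to vanish.
zero⇒≈ : ∀ {F G H} → F ⊖ G ≈ H → Zero H → F ≈ G
zero⇒≈ {F} {G} p z n = ℤ.i-j≡0⇒i≡j (F n) (G n) (trans (p n) (z n))

-- Orders of vanishing

VanishesBelow : ℕ → PowerSeries → Set
VanishesBelow n F = ∀ i → i < n → F i ≡ 0ℤ

vanishes-⊕ : ∀ {n F G} → VanishesBelow n F → VanishesBelow n G → VanishesBelow n (F ⊕ G)
vanishes-⊕ p q i i<n = cong₂ ℤ._+_ (p i i<n) (q i i<n)

vanishes-⊛ : ∀ G {n F} → VanishesBelow n F → VanishesBelow n (G ⊛ F)
vanishes-⊛ G {n} {F} p i i<n = trans (⊛-comm G F i) (go F G p i i<n)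
  where
  go : ∀ {n} F G → VanishesBelow n F → VanishesBelow n (F ⊛ G)
  go F G p zero    0<n       = cong (λ a → a ℤ.* G 0 ℤ.+ 0ℤ) (p 0 0<n)
  go F G p (suc i) (s≤s i<n) = cong₂ ℤ._+_
    (cong (ℤ._* G (suc i)) (p 0 (s≤s z≤n)))
    (go (tail F) G (λ j j<n → p (suc j) (s≤s j<n)) i i<n)

X-⊛-suc : ∀ F n → (X ⊛ F) (suc n) ≡ F n
X-⊛-suc F n = begin
  0ℤ ℤ.* F (suc n) ℤ.+ (tail X ⊛ F) n
    ≡⟨ ℤ.+-identityˡ _ ⟩
  (tail X ⊛ F) n
    ≡⟨ ⊛-congʳ F tailX≈𝟏 n ⟩
  (𝟏 ⊛ F) n
    ≡⟨ ⊛-identityˡ F n ⟩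
  F n ∎
  where
  open ≡-Reasoning
  tailX≈𝟏 : tail X ≈ 𝟏
  tailX≈𝟏 zero    = refl
  tailX≈𝟏 (suc _) = refl

vanishes-X⊛ : ∀ {n F} → VanishesBelow n F → VanishesBelow (suc n) (X ⊛ F)
vanishes-X⊛ p zero    _         = refl
vanishes-X⊛ {F = F} p (suc i) (s≤s i<n) = trans (X-⊛-suc F i) (p i i<n)

-- The factor `X` raises the order of vanishing by one, so `F` vanishes to every order.
contraction-zero : ∀ {F} G → F ≈ X ⊛ (G ⊛ F) → Zero F
contraction-zero {F} G p n = below (suc n) n ℕ.≤-refl
  where
  below : ∀ n → VanishesBelow n F
  below (suc n) i i<n = trans (p i) (vanishes-X⊛ (vanishes-⊛ G (below n)) i i<n)

P : PowerSeries
P = 𝟏 ⊖ X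

≈-refl : ∀ {F} → F ≈ F
≈-refl _ = refl

≈-zero : ∀ {F G} → F ≈ G → Zero G → Zero F
≈-zero p z n = trans (p n) (z n)

-- The solver reads the constant 1 as `const 1ℤ`, whereas a zeroth power is read as 𝟏.
one : ∀ {n} → PS.Polynomial (suc n)
one = PS.var Fin.zero ⊠^ 0

-- `P ⊛ F = 0` says `F = X ⊛ F`, a contraction.
P-cancel : ∀ {F} → Zero (P ⊛ F) → Zero F
P-cancel {F} z = contraction-zero 𝟏 (zero⇒≈
  (ring 2 (λ x f → f ⊟ x ⊠ (one ⊠ f) ≐ (one ⊟ x) ⊠ f) (X ∷ F ∷ [])) z)

-- Solving the recurrence in the slack

module Kernel
  (U A : ℕ → PowerSeries)
  (A-eq   : ∀ d → P ⊛ (P ⊛ A d) ≈ P ⊛ U d ⊕ X ⊛ (X ⊛ U (suc d)))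
  (U-zero : P ⊛ U 0 ≈ 𝟏 ⊕ X ⊛ A 0)
  (U-suc  : ∀ d → P ⊛ U (suc d) ≈ P ⊛ U d ⊕ X ⊛ A (suc d))
  where

  -- Chosen so that `P³ = 1 − X K`: the recurrence for `E` can then be written with leading
  -- coefficient 1 and all other terms divisible by `X`.
  K : PowerSeries
  K = const (+ 3) ⊖ const (+ 3) ⊛ X ⊕ X ⊛ X

  -- What remains after eliminating `A`: `P²` times the equation for `U d` plus `X` times the
  -- equation for `A d`. Only `R 0` has an inhomogeneous term, `P²`.
  R : ℕ → PowerSeries
  R zero    = P ⊛ (P ⊛ (P ⊛ U 0)) ⊖ P ⊛ P ⊖ X ⊛ (P ⊛ U 0) ⊖ X ⊛ (X ⊛ (X ⊛ U 1))
  R (suc d) = P ⊛ (P ⊛ (P ⊛ (U (suc d) ⊖ U d))) ⊖ X ⊛ (P ⊛ U (suc d)) ⊖ X ⊛ (X ⊛ (X ⊛ U (suc (suc d))))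

  R-zero : ∀ d → Zero (R d)
  R-zero zero = ≈-zero
    (ring 4 (λ x u v a → let p = one ⊟ x in
      p ⊠ (p ⊠ (p ⊠ u)) ⊟ p ⊠ p ⊟ x ⊠ (p ⊠ u) ⊟ x ⊠ (x ⊠ (x ⊠ v))
      ≐
      p ⊠ p ⊠ (p ⊠ u ⊟ (one ⊞ x ⊠ a))
        ⊞ x ⊠ (p ⊠ (p ⊠ a) ⊟ (p ⊠ u ⊞ x ⊠ (x ⊠ v))))
      (X ∷ U 0 ∷ U 1 ∷ A 0 ∷ []))
    (zero-⊕ (zero-⊛ (P ⊛ P) (≈⇒zero U-zero)) (zero-⊛ X (≈⇒zero (A-eq 0))))
  R-zero (suc d) = ≈-zero
    (ring 5 (λ x u v w a → let p = one ⊟ x in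
      p ⊠ (p ⊠ (p ⊠ (v ⊟ u))) ⊟ x ⊠ (p ⊠ v) ⊟ x ⊠ (x ⊠ (x ⊠ w))
      ≐
      p ⊠ p ⊠ (p ⊠ v ⊟ (p ⊠ u ⊞ x ⊠ a))
        ⊞ x ⊠ (p ⊠ (p ⊠ a) ⊟ (p ⊠ v ⊞ x ⊠ (x ⊠ w))))
      (X ∷ U d ∷ U (suc d) ∷ U (suc (suc d)) ∷ A (suc d) ∷ []))
    (zero-⊕ (zero-⊛ (P ⊛ P) (≈⇒zero (U-suc d))) (zero-⊛ X (≈⇒zero (A-eq (suc d)))))

  Q : PowerSeries
  Q = P ⊛ U 0

  -- E measures the failure of U (d + 1) = P U 0 U d.  It satisfies the homogeneous form of R d = 0
  -- with E 0 = 0; Φ collects the terms divisible by X.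
  E : ℕ → PowerSeries
  E zero    = const 0ℤ
  E (suc d) = U (suc d) ⊖ Q ⊛ U d

  Φ : ℕ → PowerSeries
  Φ d = K ⊛ (E (suc d) ⊖ E d) ⊕ P ⊛ E (suc d) ⊕ X ⊛ X ⊛ E (suc (suc d))

  -- This is `R (d + 1) − Q R d`, with `P³` rewritten through `K`. For `d = 0` the term `Q P²`
  -- cancels `P³ U 0` because `Q = P U 0`; this is what permits `E 0 = 0`.
  E-suc : ∀ d → E (suc d) ≈ E d ⊕ X ⊛ Φ d
  E-suc zero    = zero⇒≈
    (ring 4 (λ x u v w → let
        p  = one ⊟ x
        t  = con′ (+ 3) ⊟ con′ (+ 3) ⊠ x ⊞ x ⊠ x
        e₀ = con′ 0ℤ
        e₁ = v ⊟ p ⊠ u ⊠ u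
        e₂ = w ⊟ p ⊠ u ⊠ v
      in
      e₁ ⊟ (e₀ ⊞ x ⊠ (t ⊠ (e₁ ⊟ e₀) ⊞ p ⊠ e₁ ⊞ x ⊠ x ⊠ e₂))
      ≐
      p ⊠ (p ⊠ (p ⊠ (v ⊟ u))) ⊟ x ⊠ (p ⊠ v) ⊟ x ⊠ (x ⊠ (x ⊠ w))
        ⊞ neg (p ⊠ u) ⊠
          (p ⊠ (p ⊠ (p ⊠ u)) ⊟ p ⊠ p ⊟ x ⊠ (p ⊠ u) ⊟ x ⊠ (x ⊠ (x ⊠ v))))
      (X ∷ U 0 ∷ U 1 ∷ U 2 ∷ []))
    (zero-⊕ (R-zero 1) (zero-⊛ (⊝ (P ⊛ U 0)) (R-zero 0)))
  E-suc (suc d) = zero⇒≈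
    (ring 6 (λ x q u v w y → let
        p  = one ⊟ x
        t  = con′ (+ 3) ⊟ con′ (+ 3) ⊠ x ⊞ x ⊠ x
        e₀ = v ⊟ q ⊠ u
        e₁ = w ⊟ q ⊠ v
        e₂ = y ⊟ q ⊠ w
      in
      e₁ ⊟ (e₀ ⊞ x ⊠ (t ⊠ (e₁ ⊟ e₀) ⊞ p ⊠ e₁ ⊞ x ⊠ x ⊠ e₂))
      ≐
      p ⊠ (p ⊠ (p ⊠ (w ⊟ v))) ⊟ x ⊠ (p ⊠ w) ⊟ x ⊠ (x ⊠ (x ⊠ y))
        ⊞ neg q ⊠
          (p ⊠ (p ⊠ (p ⊠ (v ⊟ u))) ⊟ x ⊠ (p ⊠ v) ⊟ x ⊠ (x ⊠ (x ⊠ w))))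
      (X ∷ Q ∷ U d ∷ U (suc d) ∷ U (suc (suc d)) ∷ U (suc (suc (suc d))) ∷ []))
    (zero-⊕ (R-zero (suc (suc d))) (zero-⊛ (⊝ (P ⊛ U 0)) (R-zero (suc d))))

  -- Induction on the order `n` and, inside it, on `d`: `E d` is covered by the inner hypothesis,
  -- while `Φ d`, which involves larger indices, is needed only to the smaller order.
  E-vanishes : ∀ n d → VanishesBelow n (E d)
  E-vanishes (suc n) zero    i i<n = const-0 i
  E-vanishes (suc n) (suc d) i i<n = trans (E-suc d i)
    (vanishes-⊕ (E-vanishes (suc n) d)
      (vanishes-X⊛ (vanishes-⊕ (vanishes-⊕
        (vanishes-⊛ K (λ j j<n → cong₂ ℤ._-_ (E-vanishes n (suc d) j j<n) (E-vanishes n d j j<n)))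
        (vanishes-⊛ P (E-vanishes n (suc d))))
        (vanishes-⊛ (X ⊛ X) (E-vanishes n (suc (suc d)))))) i i<n)

  -- Substitute `U 1 = P U 0 U 0`, that is `E 1 = 0`, into `R 0 = 0`; every term then has a factor
  -- `P`, which is cancelled.
  U-quadratic : P ⊛ (P ⊛ U 0) ≈ P ⊕ X ⊛ U 0 ⊕ X ⊛ (X ⊛ (X ⊛ (U 0 ⊛ U 0)))
  U-quadratic = zero⇒≈ ≈-refl (P-cancel (≈-zero
    (ring 3 (λ x u v → let
        p = one ⊟ x
      in
      p ⊠ (p ⊠ (p ⊠ u) ⊟ (p ⊞ x ⊠ u ⊞ x ⊠ (x ⊠ (x ⊠ (u ⊠ u)))))
      ≐
      (p ⊠ (p ⊠ (p ⊠ u)) ⊟ p ⊠ p ⊟ x ⊠ (p ⊠ u) ⊟ x ⊠ (x ⊠ (x ⊠ v)))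
        ⊞ x ⊠ (x ⊠ x) ⊠ (v ⊟ p ⊠ u ⊠ u))
      (X ∷ U 0 ∷ U 1 ∷ []))
    (zero-⊕ (R-zero 0) (zero-⊛ (X ⊛ (X ⊛ X)) (λ n → E-vanishes (suc n) 1 n ℕ.≤-refl)))))

-- From the quadratic equation to the square root

sqrt-solution : ∀ F U →
  F ≈ 𝟏 ⊕ X ⊛ U →
  P ⊛ (P ⊛ U) ≈ P ⊕ X ⊛ U ⊕ X ⊛ (X ⊛ (X ⊛ (U ⊛ U))) →
  ∃ λ S →
    S IsSqrtOf ((𝟏 ⊖ 3 · X ⊕ X ⊛^ 2) ⊛^ 2 ⊖ 4 · X ⊛^ 3 ⊛ (𝟏 ⊖ X)) ×
    2 · X ⊛^ 2 ⊛ F ≈ 𝟏 ⊖ 3 · X ⊕ 3 · X ⊛^ 2 ⊖ S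
sqrt-solution F U F-eq U-eq = S , (refl , S²) , λ n →
  solve 2 (λ q y → y := q :- (q :- y)) refl
    ((𝟏 ⊖ 3 · X ⊕ 3 · X ⊛^ 2) n) ((2 · X ⊛^ 2 ⊛ F) n)
  where
  S S′ : PowerSeries
  S  = 𝟏 ⊖ 3 · X ⊕ 3 · X ⊛^ 2 ⊖ 2 · X ⊛^ 2 ⊛ F
  -- Primed series replace integer multiples by products with constants, which the solver
  -- understands, and `F` by `𝟏 ⊕ X ⊛ U`.
  S′ = 𝟏 ⊖ const (+ 3) ⊛ X ⊕ const (+ 3) ⊛ X ⊛^ 2 ⊖ const (+ 2) ⊛ X ⊛^ 2 ⊛ (𝟏 ⊕ X ⊛ U)

  ·≈ : ∀ c G → c · G ≈ const (+ c) ⊛ G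
  ·≈ c G n = sym (const-⊛ (+ c) G n)

  S≈S′ : S ≈ S′
  S≈S′ n = cong₂ ℤ._-_
    (cong₂ ℤ._+_ (cong (ℤ._-_ (𝟏 n)) (·≈ 3 X n)) (·≈ 3 (X ⊛^ 2) n))
    (⊛-cong (·≈ 2 (X ⊛^ 2)) F-eq n)

  D D′ : PowerSeries
  D  = (𝟏 ⊖ 3 · X ⊕ X ⊛^ 2) ⊛^ 2 ⊖ 4 · X ⊛^ 3 ⊛ (𝟏 ⊖ X)
  D′ = (𝟏 ⊖ const (+ 3) ⊛ X ⊕ X ⊛^ 2) ⊛^ 2 ⊖ const (+ 4) ⊛ X ⊛^ 3 ⊛ (𝟏 ⊖ X)

  D≈D′ : D ≈ D′
  D≈D′ n = cong₂ ℤ._-_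
    (⊛-cong base (⊛-congʳ 𝟏 base) n)
    (⊛-congʳ (𝟏 ⊖ X) (·≈ 4 (X ⊛^ 3)) n)
    where
    base : 𝟏 ⊖ 3 · X ⊕ X ⊛^ 2 ≈ 𝟏 ⊖ const (+ 3) ⊛ X ⊕ X ⊛^ 2
    base m = cong (λ a → 𝟏 m ℤ.- a ℤ.+ (X ⊛^ 2) m) (·≈ 3 X m)

  S′² : S′ ⊛ S′ ≈ D′
  -- `S′ = 1 − 3x + x² − 2x³U`, so `S′² − D′` is `−4x³` times the difference of the two sides of the
  -- quadratic equation.
  S′² = zero⇒≈
    (ring 2 (λ x u → let
        p = one ⊟ x
        s = one ⊟ con′ (+ 3) ⊠ x ⊞ con′ (+ 3) ⊠ x ⊠^ 2
              ⊟ con′ (+ 2) ⊠ x ⊠^ 2 ⊠ (one ⊞ x ⊠ u)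
      in
      s ⊠ s ⊟
        ((one ⊟ con′ (+ 3) ⊠ x ⊞ x ⊠^ 2) ⊠^ 2 ⊟ con′ (+ 4) ⊠ x ⊠^ 3 ⊠ p)
      ≐
      neg (con′ (+ 4) ⊠ x ⊠^ 3) ⊠
        (p ⊠ (p ⊠ u) ⊟ (p ⊞ x ⊠ u ⊞ x ⊠ (x ⊠ (x ⊠ (u ⊠ u))))))
      (X ∷ U ∷ []))
    (zero-⊛ (⊝ (const (+ 4) ⊛ X ⊛^ 3)) (≈⇒zero U-eq))

  S² : S ⊛ S ≈ D
  S² n = trans (⊛-cong S≈S′ S≈S′ n) (trans (S′² n) (sym (D≈D′ n)))

-- The transfer system

data Pattern : Set where
  ⟨1001⟩ ⟨1011⟩ ⟨1101⟩ : Pattern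

-- The state of the current block, that is of the letters from the first occurrence of the maximum m:
-- * fresh: no zero yet and, for 1101, a single m;
-- * gap: it ends with a zero, and m may still follow;
-- * back: it ends with m but is not fresh;
-- * closed: it ends with a zero, and m may not follow any more.
-- The initial zeros form a closed block with m = 0.
data Phase : Set where
  fresh gap back closed : Phase

onZero : Pattern → Phase → Phase
onZero p      fresh  = gap
onZero ⟨1001⟩ gap    = closed
onZero ⟨1011⟩ gap    = gap
onZero ⟨1101⟩ gap    = gap
onZero p      back   = closed
onZero p      closed = closed

-- The number d is the slack asc − m.  It grows when m follows a zero, since this is an ascent.
onMax : Pattern → Phase → ℕ → Maybe (Phase × ℕ)
onMax p      gap    d = just (back , suc d)
onMax p      closed d = nothing
onMax ⟨1001⟩ fresh  d = just (fresh , d)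
onMax ⟨1011⟩ fresh  d = just (fresh , d)
onMax ⟨1101⟩ fresh  d = just (back , d)
onMax ⟨1001⟩ back   d = just (back , d)
onMax ⟨1011⟩ back   d = nothing
onMax ⟨1101⟩ back   d = just (back , d)

sumBelow : ℕ → (ℕ → ℕ) → ℕ
sumBelow zero    g = 0
sumBelow (suc k) g = g 0 ℕ.+ sumBelow k (λ i → g (suc i))

mutual
  -- Counts the admissible extensions by `n` letters. A new maximum `m + 1 + i` with `i ≤ d` adds
  -- one ascent and leaves slack `d − i`, so the count depends on `d` but not on `m`.
  ways : Pattern → Phase → ℕ → ℕ → ℕ
  ways p q d zero    = 1
  ways p q d (suc n) = ways p (onZero p q) d n ℕ.+ (waysFrom p (onMax p q d) n ℕ.+ waysNew p d n)

  waysFrom : Pattern → Maybe (Phase × ℕ) → ℕ → ℕ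
  waysFrom p nothing        n = 0
  waysFrom p (just (q , d)) n = ways p q d n

  waysNew : Pattern → ℕ → ℕ → ℕ
  waysNew p d n = sumBelow (suc d) (λ i → ways p fresh (d ∸ i) n)

series : (ℕ → ℕ) → PowerSeries
series c n = + c n

-- Generating functions of the transfer system

module GeneratingFunctions (p : Pattern) where

  W : Phase → ℕ → PowerSeries
  W q d = series (ways p q d)

  N : ℕ → PowerSeries
  N d = series (waysNew p d)

  from : Maybe (Phase × ℕ) → PowerSeries
  from nothing        = const 0ℤ
  from (just (q , d)) = W q d

  Equation : Phase → ℕ → Set
  Equation q d = Zero (W q d ⊖ (𝟏 ⊕ X ⊛ (W (onZero p q) d ⊕ (from (onMax p q d) ⊕ N d))))

  equation : ∀ q d → Equation q d
  equation q d = ≈⇒zero rec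
    where
    series-from : ∀ m n → + waysFrom p m n ≡ from m n
    series-from nothing  n = sym (const-0 n)
    series-from (just _) n = refl

    next : PowerSeries
    next = W (onZero p q) d ⊕ (from (onMax p q d) ⊕ N d)

    rec : W q d ≈ 𝟏 ⊕ X ⊛ next
    rec zero    = refl
    rec (suc n) = begin
      + ways p (onZero p q) d n ℤ.+ (+ waysFrom p (onMax p q d) n ℤ.+ N d n)
        ≡⟨ cong (λ a → + ways p (onZero p q) d n ℤ.+ (a ℤ.+ N d n)) (series-from (onMax p q d) n) ⟩
      next n
        ≡⟨ X-⊛-suc next n ⟨
      (X ⊛ next) (suc n)
        ≡⟨ ℤ.+-identityˡ _ ⟨
      0ℤ ℤ.+ (X ⊛ next) (suc n) ∎
      where open ≡-Reasoning

  closed-eq : ∀ d → P ⊛ W closed d ≈ 𝟏 ⊕ X ⊛ N d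
  closed-eq d = zero⇒≈
    (ring 3 (λ x u n → (one ⊟ x) ⊠ u ⊟ (one ⊞ x ⊠ n)
      ≐ u ⊟ (one ⊞ x ⊠ (u ⊞ (con′ 0ℤ ⊞ n)))) (X ∷ W closed d ∷ N d ∷ []))
    (equation closed d)

  closed-zero : P ⊛ W closed 0 ≈ 𝟏 ⊕ X ⊛ W fresh 0
  closed-zero n = trans (closed-eq 0 n)
    (cong (ℤ._+_ (𝟏 n)) (⊛-cong {X} ≈-refl (λ m → cong +_ (ℕ.+-identityʳ (ways p fresh 0 m))) n))

  -- The sums over new letters telescope: `N (suc d)` is by computation `W fresh (suc d) ⊕ N d`.
  closed-suc : ∀ d → P ⊛ W closed (suc d) ≈ P ⊛ W closed d ⊕ X ⊛ W fresh (suc d)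
  closed-suc d = zero⇒≈
    (ring 5 (λ x u v a n → let p = one ⊟ x in
      p ⊠ v ⊟ (p ⊠ u ⊞ x ⊠ a)
      ≐
      p ⊠ v ⊟ (one ⊞ x ⊠ (a ⊞ n)) ⊟ (p ⊠ u ⊟ (one ⊞ x ⊠ n)))
      (X ∷ W closed d ∷ W closed (suc d) ∷ W fresh (suc d) ∷ N d ∷ []))
    (zero-⊖ (≈⇒zero (closed-eq (suc d))) (≈⇒zero (closed-eq d)))

-- Polynomial form of the series in `Equation`; `g`, `h`, `k` stand for the continuations by a zero,
-- by the maximum and by a new letter.
residual : ∀ {n} (x f g h k : PS.Polynomial (suc n)) → PS.Polynomial (suc n)
residual x f g h k = f ⊟ (one ⊞ x ⊠ (g ⊞ (h ⊞ k)))

-- The three systems differ, but eliminating `gap` and `back` gives the same equation. The equation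
-- of `closed d` trades `1 + x N d` for `P W closed d`. Subtracting the equations of `back` and
-- `closed` at equal slack removes `N` and leaves `P W back = W closed`, or `W back = W closed` for
-- 1011.
fresh-eq : ∀ p → let open GeneratingFunctions p in
  ∀ d → P ⊛ (P ⊛ W fresh d) ≈ P ⊛ W closed d ⊕ X ⊛ (X ⊛ W closed (suc d))
fresh-eq ⟨1001⟩ d = zero⇒≈
  (ring 8 (λ x u v a b c n m → let
      p  = one ⊟ x
      u≡ = residual x u u (con′ 0ℤ) n
      v≡ = residual x v v (con′ 0ℤ) m
    in
    p ⊠ (p ⊠ a) ⊟ (p ⊠ u ⊞ x ⊠ (x ⊠ v))
    ≐
    p ⊠ residual x a b a n ⊞ x ⊠ p ⊠ residual x b u c n ⊞ x ⊠ x ⊠ (residual x c v c m ⊟ v≡)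
      ⊟ p ⊠ (one ⊞ x) ⊠ u≡)
    (X ∷ W closed d ∷ W closed (suc d) ∷ W fresh d ∷ W gap d ∷ W back (suc d) ∷ N d ∷ N (suc d) ∷ []))
  (zero-⊖ (zero-⊕ (zero-⊕
    (zero-⊛ P (equation fresh d))
    (zero-⊛ (X ⊛ P) (equation gap d)))
    (zero-⊛ (X ⊛ X) (zero-⊖ (equation back (suc d)) (equation closed (suc d)))))
    (zero-⊛ (P ⊛ (𝟏 ⊕ X)) (equation closed d)))
  where open GeneratingFunctions ⟨1001⟩
fresh-eq ⟨1011⟩ d = zero⇒≈
  (ring 8 (λ x u v a b c n m → let
      p  = one ⊟ x
      u≡ = residual x u u (con′ 0ℤ) n
      v≡ = residual x v v (con′ 0ℤ) m
    in
    p ⊠ (p ⊠ a) ⊟ (p ⊠ u ⊞ x ⊠ (x ⊠ v))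
    ≐
    p ⊠ residual x a b a n ⊞ x ⊠ residual x b b c n ⊞ x ⊠ x ⊠ (residual x c v (con′ 0ℤ) m ⊟ v≡)
      ⊟ u≡)
    (X ∷ W closed d ∷ W closed (suc d) ∷ W fresh d ∷ W gap d ∷ W back (suc d) ∷ N d ∷ N (suc d) ∷ []))
  (zero-⊖ (zero-⊕ (zero-⊕
    (zero-⊛ P (equation fresh d))
    (zero-⊛ X (equation gap d)))
    (zero-⊛ (X ⊛ X) (zero-⊖ (equation back (suc d)) (equation closed (suc d)))))
    (equation closed d))
  where open GeneratingFunctions ⟨1011⟩
fresh-eq ⟨1101⟩ d = zero⇒≈
  (ring 9 (λ x u v a b c e n m → let
      p  = one ⊟ x
      u≡ = residual x u u (con′ 0ℤ) n
      v≡ = residual x v v (con′ 0ℤ) m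
    in
    p ⊠ (p ⊠ a) ⊟ (p ⊠ u ⊞ x ⊠ (x ⊠ v))
    ≐
    p ⊠ p ⊠ residual x a b e n ⊞ x ⊠ p ⊠ residual x b b c n
      ⊞ x ⊠ p ⊠ (residual x e u e n ⊟ u≡) ⊞ x ⊠ x ⊠ (residual x c v c m ⊟ v≡)
      ⊟ p ⊠ u≡)
    (X ∷ W closed d ∷ W closed (suc d) ∷ W fresh d ∷ W gap d ∷ W back (suc d) ∷ W back d ∷ N d ∷ N (suc d) ∷ []))
  (zero-⊖ (zero-⊕ (zero-⊕ (zero-⊕
    (zero-⊛ (P ⊛ P) (equation fresh d))
    (zero-⊛ (X ⊛ P) (equation gap d)))
    (zero-⊛ (X ⊛ P) (zero-⊖ (equation back d) (equation closed d))))
    (zero-⊛ (X ⊛ X) (zero-⊖ (equation back (suc d)) (equation closed (suc d)))))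
    (zero-⊛ P (equation closed d)))
  where open GeneratingFunctions ⟨1101⟩

continuations : Pattern → PowerSeries
continuations p = series (ways p closed 0)

continuations-quadratic : ∀ p → let U = continuations p in
  P ⊛ (P ⊛ U) ≈ P ⊕ X ⊛ U ⊕ X ⊛ (X ⊛ (X ⊛ (U ⊛ U)))
continuations-quadratic p = Kernel.U-quadratic (W closed) (W fresh) (fresh-eq p) closed-zero closed-suc
  where open GeneratingFunctions p

-- Pattern occurrences as sublists

Increasing : (ℕ → ℕ) → Set
Increasing g = ∀ {x y} → x < y → g x < g y

increasing : ∀ {g} → (∀ n → g n < g (suc n)) → Increasing g
increasing step {x} {suc y} (s≤s x≤y) with ℕ.m≤n⇒m<n∨m≡n x≤y
... | inj₁ x<y  = ℕ.<-trans (increasing step x<y) (step y)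
... | inj₂ refl = step y

module _ {g : ℕ → ℕ} (inc : Increasing g) where

  reflects-< : ∀ {x y} → g x < g y → x < y
  reflects-< {x} {y} gx<gy with ℕ.<-cmp x y
  ... | tri< x<y _ _  = x<y
  ... | tri≈ _ refl _ = ⊥-elim (ℕ.<-irrefl refl gx<gy)
  ... | tri> _ _ y<x  = ⊥-elim (ℕ.<-asym gx<gy (inc y<x))

  injective : ∀ {x y} → g x ≡ g y → x ≡ y
  injective {x} {y} gx≡gy with ℕ.<-cmp x y
  ... | tri< x<y _ _ = ⊥-elim (ℕ.<-irrefl gx≡gy (inc x<y))
  ... | tri≈ _ x≡y _ = x≡y
  ... | tri> _ _ y<x = ⊥-elim (ℕ.<-irrefl (sym gx≡gy) (inc y<x))

  positions : ∀ τ {π} → map g τ ⊆ π → Vec (Fin (length π)) (length τ)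
  positions []      _          = []
  positions (t ∷ τ) (y ∷ʳ s)   = Vec.map Fin.suc (positions (t ∷ τ) s)
  positions (t ∷ τ) (refl ∷ s) = Fin.zero ∷ Vec.map Fin.suc (positions τ s)

  positions-< : ∀ τ {π} (s : map g τ ⊆ π) j k → j Fin.< k →
    Vec.lookup (positions τ s) j Fin.< Vec.lookup (positions τ s) k
  positions-< (t ∷ τ) (y ∷ʳ s) j k j<k
    rewrite Vec.lookup-map j Fin.suc (positions (t ∷ τ) s)
          | Vec.lookup-map k Fin.suc (positions (t ∷ τ) s) = s≤s (positions-< (t ∷ τ) s j k j<k)
  positions-< (t ∷ τ) (refl ∷ s) Fin.zero (Fin.suc k) _
    rewrite Vec.lookup-map k Fin.suc (positions τ s) = s≤s z≤n
  positions-< (t ∷ τ) (refl ∷ s) (Fin.suc j) (Fin.suc k) (s≤s j<k)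
    rewrite Vec.lookup-map j Fin.suc (positions τ s)
          | Vec.lookup-map k Fin.suc (positions τ s) = s≤s (positions-< τ s j k j<k)

  lookup-positions : ∀ τ {π} (s : map g τ ⊆ π) j →
    lookup π (Vec.lookup (positions τ s) j) ≡ g (lookup τ j)
  lookup-positions (t ∷ τ) (y ∷ʳ s) j
    rewrite Vec.lookup-map j Fin.suc (positions (t ∷ τ) s) = lookup-positions (t ∷ τ) s j
  lookup-positions (t ∷ τ) (refl ∷ s) Fin.zero = refl
  lookup-positions (t ∷ τ) (refl ∷ s) (Fin.suc j)
    rewrite Vec.lookup-map j Fin.suc (positions τ s) = lookup-positions τ s j

  -- An increasing `g` preserves and reflects both order and equality, which is all that an
  -- occurrence asks of the letters.
  ⊆⇒contains : ∀ τ {π} → map g τ ⊆ π → π Contains τ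
  ⊆⇒contains τ s = positions τ s , positions-< τ s ,
    λ j k → order (lookup-positions τ s j) (lookup-positions τ s k)
    where
    order : ∀ {a b x y} → a ≡ g x → b ≡ g y → (a < b ⇔ x < y) × (a ≡ b ⇔ x ≡ y)
    order refl refl = mk⇔ reflects-< inc , mk⇔ injective (cong g)

-- Strictly increasing indices that have passed the head of the list can be lowered into its tail.
predVec : ∀ {n m} (ι : Vec (Fin (suc n)) m) → (∀ j → 0 < toℕ (Vec.lookup ι j)) →
  ∃ λ κ → ι ≡ Vec.map Fin.suc κ
predVec []              _ = [] , refl
predVec (Fin.zero ∷ ι)  h with h Fin.zero
... | ()
predVec (Fin.suc i ∷ ι) h with predVec ι (h ∘ Fin.suc)
... | κ , refl = i ∷ κ , refl

subword : ∀ {m} (π : List ℕ) (ι : Vec (Fin (length π)) m) → List ℕ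
subword π ι = Vec.toList (Vec.map (lookup π) ι)

subword-suc : ∀ {m} x π (κ : Vec (Fin (length π)) m) →
  subword (x ∷ π) (Vec.map Fin.suc κ) ≡ subword π κ
subword-suc x π κ = cong Vec.toList (sym (Vec.map-∘ (lookup (x ∷ π)) Fin.suc κ))

StrictlyIncreasing : ∀ {n m} → Vec (Fin n) m → Set
StrictlyIncreasing ι = ∀ j k → j Fin.< k → Vec.lookup ι j Fin.< Vec.lookup ι k

mutual
  subword-⊆ : ∀ {m} π (ι : Vec (Fin (length π)) m) → StrictlyIncreasing ι → subword π ι ⊆ π
  subword-⊆ π       []              _ = minimum π
  subword-⊆ (x ∷ π) (Fin.zero ∷ ι)  h with predVec ι (λ j → h Fin.zero (Fin.suc j) (s≤s z≤n))
  ... | κ , refl = refl ∷ subword-suc-⊆ x π κ (λ j k j<k → h (Fin.suc j) (Fin.suc k) (s≤s j<k))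
  subword-⊆ (x ∷ π) ι@(Fin.suc i ∷ _) h with predVec ι positive
    where
    positive : ∀ j → 0 < toℕ (Vec.lookup ι j)
    positive Fin.zero    = s≤s z≤n
    positive (Fin.suc j) = ℕ.≤-<-trans z≤n (h Fin.zero (Fin.suc j) (s≤s z≤n))
  ... | κ , eq = subst (λ ι → subword (x ∷ π) ι ⊆ x ∷ π) (sym eq)
    (x ∷ʳ subword-suc-⊆ x π κ (subst StrictlyIncreasing eq h))

  subword-suc-⊆ : ∀ {m} x π (κ : Vec (Fin (length π)) m) →
    StrictlyIncreasing (Vec.map Fin.suc κ) → subword (x ∷ π) (Vec.map Fin.suc κ) ⊆ π
  subword-suc-⊆ x π κ h = subst (_⊆ π) (sym (subword-suc x π κ)) (subword-⊆ π κ h′)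
    where
    h′ : StrictlyIncreasing κ
    h′ j k j<k with h j k j<k
    ... | lt rewrite Vec.lookup-map j Fin.suc κ | Vec.lookup-map k Fin.suc κ = ℕ.s≤s⁻¹ lt

-- Ascent sequences read from right to left

rascents : List ℕ → ℕ
rascents []          = 0
rascents (_ ∷ [])    = 0
rascents (a ∷ l ∷ r) = (if l ℕ.<ᵇ a then 1 else 0) + rascents (l ∷ r)

-- With the newest letter at the head, appending a letter is a cons and prefixes of the word are
-- suffixes of the list.
Growth : List ℕ → Set
Growth []      = ⊤
Growth (a ∷ r) = a ≤ rascents r + 1 × Growth r

-- The letter `l` appears in both summands, so the step from `l` to the first letter of `w` is
-- counted exactly once.
rascents-ʳ++ : ∀ l w r → rascents (w ʳ++ (l ∷ r)) ≡ asc (l ∷ w) + rascents (l ∷ r)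
rascents-ʳ++ l []      r = refl
rascents-ʳ++ l (b ∷ w) r = begin
  rascents (w ʳ++ (b ∷ l ∷ r))
    ≡⟨ rascents-ʳ++ b w (l ∷ r) ⟩
  asc (b ∷ w) + (up + rascents (l ∷ r))
    ≡⟨ ℕ.+-assoc (asc (b ∷ w)) up _ ⟨
  asc (b ∷ w) + up + rascents (l ∷ r)
    ≡⟨ cong (_+ rascents (l ∷ r)) (ℕ.+-comm (asc (b ∷ w)) up) ⟩
  up + asc (b ∷ w) + rascents (l ∷ r) ∎
  where
  open ≡-Reasoning
  up : ℕ
  up = if l ℕ.<ᵇ b then 1 else 0

growth-suffix : ∀ w r → Growth (w ʳ++ r) → Growth r
growth-suffix []      r g = g
growth-suffix (a ∷ w) r g = proj₂ (growth-suffix w (a ∷ r) g)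

growth⇒bounds : ∀ w r → Growth (w ʳ++ r) →
  ∀ i → lookup w i ≤ rascents (take (toℕ i) w ʳ++ r) + 1
growth⇒bounds (a ∷ w) r g Fin.zero    = proj₁ (growth-suffix w (a ∷ r) g)
growth⇒bounds (a ∷ w) r g (Fin.suc i) = growth⇒bounds w (a ∷ r) g i

bounds⇒growth : ∀ w r → Growth r →
  (∀ i → lookup w i ≤ rascents (take (toℕ i) w ʳ++ r) + 1) → Growth (w ʳ++ r)
bounds⇒growth []      r g h = g
bounds⇒growth (a ∷ w) r g h = bounds⇒growth w (a ∷ r) (h Fin.zero , g) (h ∘ Fin.suc)

rascents-reverse : ∀ l w → rascents (w ʳ++ (l ∷ [])) ≡ asc (l ∷ w)
rascents-reverse l w = trans (rascents-ʳ++ l w []) (ℕ.+-identityʳ _)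

isAscentSequence⇔growth : ∀ w → IsAscentSequence (0 ∷ w) ⇔ Growth (reverse (0 ∷ w))
isAscentSequence⇔growth w = mk⇔ to from
  where
  to : IsAscentSequence (0 ∷ w) → Growth (reverse (0 ∷ w))
  to h = bounds⇒growth w (0 ∷ []) (z≤n , tt) λ i →
    subst (λ k → lookup w i ≤ k + 1) (sym (rascents-reverse 0 (take (toℕ i) w)))
      (proj₂ (h (Fin.suc i)) (s≤s z≤n))

  from : Growth (reverse (0 ∷ w)) → IsAscentSequence (0 ∷ w)
  from g Fin.zero    = (λ _ → refl) , λ ()
  from g (Fin.suc i) = (λ ()) , λ _ →
    subst (λ k → lookup w i ≤ k + 1) (rascents-reverse 0 (take (toℕ i) w))
      (growth⇒bounds w (0 ∷ []) g i)

-- Avoidance in reversed words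

word : Pattern → List ℕ
word ⟨1001⟩ = 1 ∷ 0 ∷ 0 ∷ 1 ∷ []
word ⟨1011⟩ = 1 ∷ 0 ∷ 1 ∷ 1 ∷ []
word ⟨1101⟩ = 1 ∷ 1 ∷ 0 ∷ 1 ∷ []

-- An occurrence of p on the values c < b, without its last letter b and reversed.
context : Pattern → ℕ → ℕ → List ℕ
context ⟨1001⟩ b c = c ∷ c ∷ b ∷ []
context ⟨1011⟩ b c = b ∷ c ∷ b ∷ []
context ⟨1101⟩ b c = c ∷ b ∷ b ∷ []

No021 : List ℕ → Set
No021 r = ∀ {x y z} → x < z → z < y → ¬ (z ∷ y ∷ x ∷ [] ⊆ r)

NoPattern : Pattern → List ℕ → Set
NoPattern p r = ∀ {b c} → c < b → ¬ (b ∷ context p b c ⊆ r)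

record Good (p : Pattern) (r : List ℕ) : Set where
  constructor good
  field
    growth    : Growth r
    no021     : No021 r
    noPattern : NoPattern p r

avoids021⇒ : ∀ w → w Avoids (0 ∷ 2 ∷ 1 ∷ []) → No021 (reverse w)
avoids021⇒ w avoids {x} {y} {z} x<z z<y s =
  avoids (⊆⇒contains {g} (increasing step) (0 ∷ 2 ∷ 1 ∷ []) {w} (reverse⁻ s))
  where
  -- The values `x`, `z`, `y` at 0, 1, 2, extended to an increasing function on all of ℕ.
  g : ℕ → ℕ
  g 0             = x
  g 1             = z
  g (suc (suc n)) = n + y

  step : ∀ n → g n < g (suc n)
  step 0             = x<z
  step 1             = z<y
  step (suc (suc n)) = ℕ.≤-refl

no021⇒ : ∀ w → No021 (reverse w) → w Avoids (0 ∷ 2 ∷ 1 ∷ [])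
no021⇒ w absent (ι@(i ∷ j ∷ k ∷ []) , inc , order) =
  absent (Equivalence.from (proj₁ (order 0F 2F)) (s≤s z≤n)) (Equivalence.from (proj₁ (order 2F 1F)) (s≤s (s≤s z≤n)))
     (reverse⁺ (subword-⊆ w ι inc))

avoids⇒ : ∀ p w → w Avoids (word p) → NoPattern p (reverse w)
avoids⇒ p w avoids {b} {c} c<b s = avoids (⊆⇒contains {g} (increasing step) (word p) {w} (sublist p s))
  where
  g : ℕ → ℕ
  g 0       = c
  g (suc n) = n + b

  step : ∀ n → g n < g (suc n)
  step 0       = c<b
  step (suc n) = ℕ.≤-refl

  sublist : ∀ p → b ∷ context p b c ⊆ reverse w → map g (word p) ⊆ w
  sublist ⟨1001⟩ = reverse⁻
  sublist ⟨1011⟩ = reverse⁻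
  sublist ⟨1101⟩ = reverse⁻

-- Equal pattern entries force equal letters; rewriting with the two equalities leaves two values,
-- and the subword becomes `b ∷ context p b c`.
noPattern⇒ : ∀ p w → NoPattern p (reverse w) → w Avoids (word p)
noPattern⇒ ⟨1001⟩ w absent (ι@(i ∷ j ∷ k ∷ l ∷ []) , inc , order)
  with eq₁ ← Equivalence.from (proj₂ (order 3F 0F)) refl
     | eq₂ ← Equivalence.from (proj₂ (order 2F 1F)) refl
     | lt  ← Equivalence.from (proj₁ (order 1F 0F)) (s≤s z≤n)
     | s   ← reverse⁺ (subword-⊆ w ι inc)
  rewrite eq₁ | eq₂ = absent lt s
noPattern⇒ ⟨1011⟩ w absent (ι@(i ∷ j ∷ k ∷ l ∷ []) , inc , order)
  with eq₁ ← Equivalence.from (proj₂ (order 3F 0F)) refl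
     | eq₂ ← Equivalence.from (proj₂ (order 2F 0F)) refl
     | lt  ← Equivalence.from (proj₁ (order 1F 0F)) (s≤s z≤n)
     | s   ← reverse⁺ (subword-⊆ w ι inc)
  rewrite eq₁ | eq₂ = absent lt s
noPattern⇒ ⟨1101⟩ w absent (ι@(i ∷ j ∷ k ∷ l ∷ []) , inc , order)
  with eq₁ ← Equivalence.from (proj₂ (order 3F 0F)) refl
     | eq₂ ← Equivalence.from (proj₂ (order 1F 0F)) refl
     | lt  ← Equivalence.from (proj₁ (order 2F 0F)) (s≤s z≤n)
     | s   ← reverse⁺ (subword-⊆ w ι inc)
  rewrite eq₁ | eq₂ = absent lt s

B⇔good : ∀ p n w → length w ≡ n → B (word p) (suc n) (0 ∷ w) ⇔ Good p (w ʳ++ (0 ∷ []))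
B⇔good p n w len = mk⇔
  (λ (_ , isAsc , avoids021 , avoids) → good
    (Equivalence.to (isAscentSequence⇔growth w) isAsc)
    (avoids021⇒ (0 ∷ w) avoids021)
    (avoids⇒ p (0 ∷ w) avoids))
  (λ (good growth no021 noPattern) → cong suc len
    , Equivalence.from (isAscentSequence⇔growth w) growth
    , no021⇒ (0 ∷ w) no021
    , noPattern⇒ p (0 ∷ w) noPattern)

-- The invariant of the scan

tail-good : ∀ {p a r} → Good p (a ∷ r) → Good p r
tail-good {a = a} (good (_ , g) n021 np) = good g
  (λ x<z z<y s → n021 x<z z<y (a ∷ʳ s)) (λ c<b s → np c<b (a ∷ʳ s))

-- Lets one inadmissible letter discard all its continuations at once.
suffix-good : ∀ {p} w {r} → Good p (w ʳ++ r) → Good p r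
suffix-good []      g = g
suffix-good (a ∷ w) g = tail-good (suffix-good w g)

-- Only occurrences whose last letter is the new `a` remain to be excluded.
cons-good : ∀ {p a r} → Good p r →
  a ≤ rascents r + 1 →
  (∀ {x y} → x < a → a < y → ¬ (y ∷ x ∷ [] ⊆ r)) →
  (∀ {c} → c < a → ¬ (context p a c ⊆ r)) →
  Good p (a ∷ r)
cons-good {p} {a} {r} (good g n021 np) bound h021 hp = good (bound , g) n021′ np′
  where
  n021′ : No021 (a ∷ r)
  n021′ x<z z<y (_ ∷ʳ s)   = n021 x<z z<y s
  n021′ x<z z<y (refl ∷ s) = h021 x<z z<y s

  np′ : NoPattern p (a ∷ r)
  np′ c<b (_ ∷ʳ s)   = np c<b s
  np′ c<b (refl ∷ s) = hp c<b s

-- What each phase asserts about the word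

lastLetter : Phase → ℕ → ℕ
lastLetter fresh  m = m
lastLetter gap    m = 0
lastLetter back   m = m
lastLetter closed m = 0

Single : Pattern → ℕ → List ℕ → Set
Single ⟨1001⟩ m r = ⊤
Single ⟨1011⟩ m r = ⊤
Single ⟨1101⟩ m r = ¬ (m ∷ m ∷ [] ⊆ r)

-- Phases that admit `m` exclude every context of `m`, with any lower letter `c`. Phases that do not
-- admit it hold an actual context with `c = 0`; the premise `0 < m` exempts the initial zeros. The
-- remaining sublists are those from which the next phase builds its own.
Block : Pattern → Phase → ℕ → List ℕ → Set
Block p      fresh  m r = (m ∷ [] ⊆ r) × (∀ {c} → c < m → ¬ (c ∷ m ∷ [] ⊆ r)) × Single p m r
Block ⟨1001⟩ gap    m r = (0 ∷ m ∷ [] ⊆ r) × (∀ {c} → c < m → ¬ (c ∷ c ∷ m ∷ [] ⊆ r))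
Block ⟨1011⟩ gap    m r = (0 ∷ m ∷ [] ⊆ r) × (∀ {c} → c < m → ¬ (m ∷ c ∷ m ∷ [] ⊆ r))
Block ⟨1101⟩ gap    m r = (0 ∷ m ∷ [] ⊆ r) × ¬ (m ∷ m ∷ [] ⊆ r)
Block ⟨1001⟩ back   m r = (0 ∷ m ∷ [] ⊆ r) × (∀ {c} → c < m → ¬ (c ∷ c ∷ m ∷ [] ⊆ r))
Block ⟨1011⟩ back   m r = m ∷ 0 ∷ m ∷ [] ⊆ r
Block ⟨1101⟩ back   m r = (m ∷ m ∷ [] ⊆ r) × (∀ {c} → c < m → ¬ (c ∷ m ∷ m ∷ [] ⊆ r))
Block p      closed m r = 0 < m → context p m 0 ⊆ r

last₂ : ∀ {x y z : ℕ} {r} → x ∷ y ∷ z ∷ [] ⊆ r → x ∷ z ∷ [] ⊆ r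
last₂ {y = y} s = ⊆-trans (refl ∷ y ∷ʳ refl ∷ []) s

single-zero : ∀ p {m r} → 0 < m → Single p m r → Single p m (0 ∷ r)
single-zero ⟨1001⟩ _   _ = tt
single-zero ⟨1011⟩ _   _ = tt
single-zero ⟨1101⟩ 0<m h (_ ∷ʳ s)   = h s
single-zero ⟨1101⟩ ()  h (refl ∷ s)

block-zero : ∀ p q {m r} → (q ≢ closed → 0 < m) → Block p q m r → Block p (onZero p q) m (0 ∷ r)
block-zero ⟨1001⟩ fresh pos (mem , only , _) = refl ∷ mem , λ
  { c<m (_ ∷ʳ s)   → only c<m (∷ˡ⁻ s)
  ; c<m (refl ∷ s) → only c<m s }
block-zero ⟨1011⟩ fresh pos (mem , only , _) = refl ∷ mem , λ
  { c<m (_ ∷ʳ s)   → only c<m (∷ˡ⁻ s)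
  ; () (refl ∷ s) }
block-zero ⟨1101⟩ fresh pos (mem , only , single) =
  refl ∷ mem , single-zero ⟨1101⟩ (pos λ ()) single
block-zero ⟨1001⟩ gap pos (mem , _) _ = refl ∷ mem
block-zero ⟨1011⟩ gap pos (mem , only) = 0 ∷ʳ mem , λ
  { c<m (_ ∷ʳ s)   → only c<m s
  ; () (refl ∷ s) }
block-zero ⟨1101⟩ gap pos (mem , single) = 0 ∷ʳ mem , single-zero ⟨1101⟩ (pos λ ()) single
block-zero ⟨1001⟩ back pos (mem , _) _ = refl ∷ mem
block-zero ⟨1011⟩ back pos mem       _ = 0 ∷ʳ mem
block-zero ⟨1101⟩ back pos (mem , _) _ = refl ∷ mem
block-zero p closed pos dead 0<m = 0 ∷ʳ dead 0<m

block-max : ∀ p q {d q′ d′ m r} → onMax p q d ≡ just (q′ , d′) → Block p q m r → Block p q′ m (m ∷ r)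
block-max ⟨1001⟩ fresh refl (mem , only , _) = _ ∷ʳ mem , (λ
  { c<m (_ ∷ʳ s)   → only c<m s
  ; c<m (refl ∷ s) → ℕ.<-irrefl refl c<m }) , tt
block-max ⟨1011⟩ fresh refl (mem , only , _) = _ ∷ʳ mem , (λ
  { c<m (_ ∷ʳ s)   → only c<m s
  ; c<m (refl ∷ s) → ℕ.<-irrefl refl c<m }) , tt
block-max ⟨1101⟩ fresh refl (mem , only , _) = refl ∷ mem , λ
  { c<m (_ ∷ʳ s)   → only c<m (last₂ s)
  ; c<m (refl ∷ s) → ℕ.<-irrefl refl c<m }
block-max ⟨1001⟩ gap refl (mem , only) = _ ∷ʳ mem , λ
  { c<m (_ ∷ʳ s)   → only c<m s
  ; c<m (refl ∷ s) → ℕ.<-irrefl refl c<m }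
block-max ⟨1011⟩ gap refl (mem , only) = refl ∷ mem
block-max ⟨1101⟩ gap refl (mem , single) = refl ∷ ∷ˡ⁻ mem , λ
  { c<m (_ ∷ʳ s)   → single (∷ˡ⁻ s)
  ; c<m (refl ∷ s) → ℕ.<-irrefl refl c<m }
block-max ⟨1001⟩ back refl (mem , only) = _ ∷ʳ mem , λ
  { c<m (_ ∷ʳ s)   → only c<m s
  ; c<m (refl ∷ s) → ℕ.<-irrefl refl c<m }
block-max ⟨1101⟩ back refl (mem , only) = _ ∷ʳ mem , λ
  { c<m (_ ∷ʳ s)   → only c<m s
  ; c<m (refl ∷ s) → ℕ.<-irrefl refl c<m }

block-new : ∀ p {a r} → ¬ (a ∷ [] ⊆ r) → Block p fresh a (a ∷ r)
block-new p {a} {r} absent = refl ∷ minimum r , (λ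
  { c<a (_ ∷ʳ s)   → absent (∷ˡ⁻ s)
  ; c<a (refl ∷ s) → ℕ.<-irrefl refl c<a }) , single p
  where
  single : ∀ p → Single p a (a ∷ r)
  single ⟨1001⟩ = tt
  single ⟨1011⟩ = tt
  single ⟨1101⟩ (_ ∷ʳ s)   = absent (∷ˡ⁻ s)
  single ⟨1101⟩ (refl ∷ s) = absent s

context-∋ : ∀ p {b c r} → context p b c ⊆ r → b ∷ [] ⊆ r
context-∋ ⟨1001⟩ s = ∷ˡ⁻ (∷ˡ⁻ s)
context-∋ ⟨1011⟩ s = ∷ˡ⁻ (∷ˡ⁻ s)
context-∋ ⟨1101⟩ s = ∷ˡ⁻ (∷ˡ⁻ s)

-- Supplies the pattern hypothesis of `cons-good` for the letter `m`. Every context contains a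
-- descent from `m` to `c`, so the phase `fresh`, where nothing smaller follows `m`, excludes them
-- all.
alive : ∀ p q {d s m r} → onMax p q d ≡ just s → Block p q m r →
  ∀ {c} → c < m → ¬ (context p m c ⊆ r)
alive ⟨1001⟩ fresh refl (_ , only , _) c<m s = only c<m (∷ˡ⁻ s)
alive ⟨1011⟩ fresh refl (_ , only , _) c<m s = only c<m (∷ˡ⁻ s)
alive ⟨1101⟩ fresh refl (_ , only , _) c<m s = only c<m (last₂ s)
alive ⟨1001⟩ gap   refl (_ , only)     c<m s = only c<m s
alive ⟨1011⟩ gap   refl (_ , only)     c<m s = only c<m s
alive ⟨1101⟩ gap   refl (_ , single)   c<m s = single (∷ˡ⁻ s)
alive ⟨1001⟩ back  refl (_ , only)     c<m s = only c<m s
alive ⟨1101⟩ back  refl (_ , only)     c<m s = only c<m s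

dead : ∀ p q {d m r} → onMax p q d ≡ nothing → Block p q m r → 0 < m → context p m 0 ⊆ r
dead ⟨1011⟩ back   refl h _   = h
dead p      closed refl h 0<m = h 0<m

-- `ascents` identifies `d` as the slack; `descends` keeps a zero before `m`, so that a letter
-- strictly between 0 and `m` would complete 021; `positive` leaves `m = 0` to the phase `closed`
-- alone.
record Invariant (p : Pattern) (q : Phase) (m d : ℕ) (r : List ℕ) : Set where
  field
    isGood   : Good p r
    ascents  : rascents r ≡ m + d
    lastIs   : ∃ λ r′ → r ≡ lastLetter q m ∷ r′
    bounded  : ∀ {y} → y ∷ [] ⊆ r → y ≤ m
    origin   : 0 ∷ [] ⊆ r
    descends : 0 < m → m ∷ 0 ∷ [] ⊆ r
    positive : q ≢ closed → 0 < m
    block    : Block p q m r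

first₁ : ∀ {x y : ℕ} {r} → x ∷ y ∷ [] ⊆ r → x ∷ [] ⊆ r
first₁ {y = y} s = ⊆-trans (refl ∷ y ∷ʳ []) s

step-up : ∀ {l a} → l < a → (if l ℕ.<ᵇ a then 1 else 0) ≡ 1
step-up {zero}  {suc a} _         = refl
step-up {suc l} {suc a} (s≤s l<a) = step-up l<a

step-level : ∀ a → (if a ℕ.<ᵇ a then 1 else 0) ≡ 0
step-level zero    = refl
step-level (suc a) = step-level a

module _ {p q m d r} (inv : Invariant p q m d r) where
  open Invariant inv

  bound⇒ : ∀ {a} → a ≤ suc (m + d) → a ≤ rascents r + 1
  bound⇒ {a} h = subst (a ≤_) (trans (cong suc (sym ascents)) (ℕ.+-comm 1 _)) h

  invariant-zero : Invariant p (onZero p q) m d (0 ∷ r)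
  invariant-zero = record
    { isGood   = cons-good isGood z≤n (λ ()) (λ ())
    ; ascents  = level lastIs
    ; lastIs   = r , cong (_∷ r) (sym (last-zero p q))
    ; bounded  = λ { (_ ∷ʳ s) → bounded s ; (refl ∷ s) → z≤n }
    ; origin   = refl ∷ minimum r
    ; descends = λ 0<m → 0 ∷ʳ descends 0<m
    ; positive = λ ne → positive λ { refl → ne refl }
    ; block    = block-zero p q positive block
    }
    where
    level : (∃ λ r′ → r ≡ lastLetter q m ∷ r′) → rascents (0 ∷ r) ≡ m + d
    level (r′ , refl) = ascents

    last-zero : ∀ p q → lastLetter (onZero p q) m ≡ 0
    last-zero p      fresh  = refl
    last-zero ⟨1001⟩ gap    = refl
    last-zero ⟨1011⟩ gap    = refl
    last-zero ⟨1101⟩ gap    = refl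
    last-zero p      back   = refl
    last-zero p      closed = refl

  invariant-max : ∀ {q′ d′} → 0 < m → onMax p q d ≡ just (q′ , d′) → Invariant p q′ m d′ (m ∷ r)
  invariant-max {q′} {d′} 0<m eq = record
    { isGood   = cons-good isGood (bound⇒ (ℕ.m≤n⇒m≤1+n (ℕ.m≤m+n m d)))
                   (λ _ m<y s → ℕ.<⇒≱ m<y (bounded (first₁ s))) (alive p q eq block)
    ; ascents  = count lastIs
    ; lastIs   = r , cong (_∷ r) (sym (last-max p q eq))
    ; bounded  = λ { (_ ∷ʳ s) → bounded s ; (refl ∷ s) → ℕ.≤-refl }
    ; origin   = m ∷ʳ origin
    ; descends = λ 0<m → m ∷ʳ descends 0<m
    ; positive = λ _ → 0<m
    ; block    = block-max p q eq block
    }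
    where
    last-max : ∀ p q → onMax p q d ≡ just (q′ , d′) → lastLetter q′ m ≡ m
    last-max ⟨1001⟩ fresh refl = refl
    last-max ⟨1011⟩ fresh refl = refl
    last-max ⟨1101⟩ fresh refl = refl
    last-max p      gap   refl = refl
    last-max ⟨1001⟩ back  refl = refl
    last-max ⟨1101⟩ back  refl = refl

    step : ∀ p q → onMax p q d ≡ just (q′ , d′) →
      (if lastLetter q m ℕ.<ᵇ m then 1 else 0) + (m + d) ≡ m + d′
    step ⟨1001⟩ fresh refl = cong (_+ (m + d)) (step-level m)
    step ⟨1011⟩ fresh refl = cong (_+ (m + d)) (step-level m)
    step ⟨1101⟩ fresh refl = cong (_+ (m + d)) (step-level m)
    step p      gap   refl = trans (cong (_+ (m + d)) (step-up 0<m)) (sym (ℕ.+-suc m d))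
    step ⟨1001⟩ back  refl = cong (_+ (m + d)) (step-level m)
    step ⟨1101⟩ back  refl = cong (_+ (m + d)) (step-level m)

    count : (∃ λ r′ → r ≡ lastLetter q m ∷ r′) → rascents (m ∷ r) ≡ m + d′
    count (r′ , refl) = trans (cong (ℕ._+_ _) ascents) (step p q eq)

  -- No pattern can end in the new letter, since every context contains an earlier copy of that
  -- letter.
  invariant-new : ∀ {i} → i ≤ d → Invariant p fresh (suc m + i) (d ∸ i) (suc m + i ∷ r)
  invariant-new {i} i≤d = record
    { isGood   = cons-good isGood (bound⇒ (s≤s (ℕ.+-monoʳ-≤ m i≤d)))
                   (λ _ a<y s → ℕ.<⇒≱ (ℕ.<-trans m<a a<y) (bounded (first₁ s)))
                   (λ _ s → absent (context-∋ p s))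
    ; ascents  = count lastIs
    ; lastIs   = r , refl
    ; bounded  = λ { (_ ∷ʳ s) → ℕ.≤-trans (bounded s) (ℕ.<⇒≤ m<a) ; (refl ∷ s) → ℕ.≤-refl }
    ; origin   = _ ∷ʳ origin
    ; descends = λ _ → refl ∷ origin
    ; positive = λ _ → s≤s z≤n
    ; block    = block-new p absent
    }
    where
    m<a : m < suc m + i
    m<a = s≤s (ℕ.m≤m+n m i)

    absent : ¬ (suc m + i ∷ [] ⊆ r)
    absent s = ℕ.<⇒≱ m<a (bounded s)

    count : (∃ λ r′ → r ≡ lastLetter q m ∷ r′) → rascents (suc m + i ∷ r) ≡ suc m + i + (d ∸ i)
    count (r′ , refl) = begin
      (if lastLetter q m ℕ.<ᵇ suc m + i then 1 else 0) + rascents r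
        ≡⟨ cong₂ _+_ (step-up (ℕ.≤-<-trans (bounded (refl ∷ minimum r′)) m<a)) ascents ⟩
      suc m + d
        ≡⟨ cong (_+_ (suc m)) (ℕ.m+[n∸m]≡n i≤d) ⟨
      suc m + (i + (d ∸ i))
        ≡⟨ ℕ.+-assoc (suc m) i _ ⟨
      suc m + i + (d ∸ i) ∎
      where open ≡-Reasoning

  reject-low : ∀ {a} → 0 < a → a < m → ¬ Good p (a ∷ r)
  reject-low 0<a a<m g = Good.no021 g 0<a a<m (refl ∷ descends (ℕ.<-trans 0<a a<m))

  reject-max : onMax p q d ≡ nothing → 0 < m → ¬ Good p (m ∷ r)
  reject-max eq 0<m g = Good.noPattern g 0<m (refl ∷ dead p q eq block 0<m)

  reject-high : ∀ {a} → suc (m + d) < a → ¬ Good p (a ∷ r)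
  reject-high {a} lt g = ℕ.<⇒≱ lt
    (subst (a ≤_) (trans (ℕ.+-comm _ 1) (cong suc ascents)) (proj₁ (Good.growth g)))

invariant-start : ∀ p → Invariant p closed 0 0 (0 ∷ [])
invariant-start p = record
  { isGood   = good (z≤n , tt) (λ { _ _ (_ ∷ʳ ()) ; _ _ (_ ∷ ()) }) (noPattern p)
  ; ascents  = refl
  ; lastIs   = [] , refl
  ; bounded  = λ { (_ ∷ʳ ()) ; (refl ∷ _) → z≤n }
  ; origin   = refl ∷ []
  ; descends = λ ()
  ; positive = λ ne → ⊥-elim (ne refl)
  ; block    = λ ()
  }
  where
  noPattern : ∀ p → NoPattern p (0 ∷ [])
  noPattern ⟨1001⟩ _ (_ ∷ʳ ())
  noPattern ⟨1001⟩ _ (_ ∷ ())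
  noPattern ⟨1011⟩ _ (_ ∷ʳ ())
  noPattern ⟨1011⟩ _ (_ ∷ ())
  noPattern ⟨1101⟩ _ (_ ∷ʳ ())
  noPattern ⟨1101⟩ _ (_ ∷ ())

-- Counting words

sumBelow-cong : ∀ k {g h} → (∀ i → i < k → g i ≡ h i) → sumBelow k g ≡ sumBelow k h
sumBelow-cong zero    eq = refl
sumBelow-cong (suc k) eq = cong₂ _+_ (eq 0 (s≤s z≤n)) (sumBelow-cong k (λ i i<k → eq (suc i) (s≤s i<k)))

sumBelow-+ : ∀ j k g → sumBelow (j + k) g ≡ sumBelow j g + sumBelow k (λ i → g (j + i))
sumBelow-+ zero    k g = refl
sumBelow-+ (suc j) k g = trans (cong (_+_ (g 0)) (sumBelow-+ j k (g ∘ suc))) (sym (ℕ.+-assoc (g 0) _ _))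

sumBelow-zero : ∀ k {g} → (∀ i → i < k → g i ≡ 0) → sumBelow k g ≡ 0
sumBelow-zero zero    eq = refl
sumBelow-zero (suc k) eq = cong₂ _+_ (eq 0 (s≤s z≤n)) (sumBelow-zero k (λ i i<k → eq (suc i) (s≤s i<k)))

count : {Q : Pred (List ℕ) 0ℓ} → Decidable Q → List (List ℕ) → ℕ
count Q? ws = length (filter Q? ws)

count-++ : {Q : Pred (List ℕ) 0ℓ} (Q? : Decidable Q) → ∀ us vs →
  count Q? (us ++ vs) ≡ count Q? us + count Q? vs
count-++ Q? us vs = trans (cong length (filter-++ Q? us vs)) (length-++ (filter Q? us))

count-map : {Q : Pred (List ℕ) 0ℓ} (Q? : Decidable Q) (h : List ℕ → List ℕ) → ∀ ws →
  count Q? (map h ws) ≡ count (Q? ∘ h) ws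
count-map Q? h []       = refl
count-map Q? h (w ∷ ws) with Q? (h w)
... | yes _ = cong suc (count-map Q? h ws)
... | no  _ = count-map Q? h ws

count-words : {Q : Pred (List ℕ) 0ℓ} (Q? : Decidable Q) → ∀ k n →
  count Q? (words k (suc n)) ≡ sumBelow k (λ a → count (Q? ∘ (a ∷_)) (words k n))
count-words Q? k n = go k id
  where
  go : ∀ j (g : ℕ → ℕ) → count Q? (cartesianProductWith _∷_ (applyUpTo g j) (words k n)) ≡
    sumBelow j (λ a → count (Q? ∘ (g a ∷_)) (words k n))
  go zero    g = refl
  go (suc j) g = trans (count-++ Q? (map (g 0 ∷_) (words k n)) _)
    (cong₂ _+_ (count-map Q? (g 0 ∷_) (words k n)) (go j (g ∘ suc)))

count-none : {Q : Pred (List ℕ) 0ℓ} (Q? : Decidable Q) → ∀ k n → (∀ w → length w ≡ n → ¬ Q w) →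
  count Q? (words k n) ≡ 0
count-none Q? k zero none with Q? []
... | yes q = ⊥-elim (none [] refl q)
... | no  _ = refl
count-none Q? k (suc n) none = trans (count-words Q? k n)
  (sumBelow-zero k λ a _ → count-none (Q? ∘ (a ∷_)) k n (λ w len → none (a ∷ w) (cong suc len)))

sumBelow-last : ∀ k {g} → (∀ i → i < k → g i ≡ 0) → sumBelow (suc k) g ≡ g k
sumBelow-last zero    eq = ℕ.+-identityʳ _
sumBelow-last (suc k) eq = cong₂ _+_ (eq 0 (s≤s z≤n)) (sumBelow-last k (λ i i<k → eq (suc i) (s≤s i<k)))

rascents-∷ : ∀ a r → rascents (a ∷ r) ≤ suc (rascents r)
rascents-∷ a []      = z≤n
rascents-∷ a (l ∷ r) with l ℕ.<ᵇ a
... | true  = ℕ.≤-refl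
... | false = ℕ.n≤1+n _

-- The alphabet splits into 0, the letters strictly between 0 and `m`, `m` itself, the `d + 1`
-- admissible new letters and the rest. The second and last groups are rejected. The size `k` stays
-- fixed; the bound on it ensures that no admissible letter is cut off in the remaining `n` steps.
count-good : ∀ n k {p q m d r} → Invariant p q m d r → suc (m + d + n) ≤ k →
  {Q : Pred (List ℕ) 0ℓ} (Q? : Decidable Q) → (∀ w → length w ≡ n → Q w ⇔ Good p (w ʳ++ r)) →
  count Q? (words k n) ≡ ways p q d n
count-good zero k inv _ Q? Q⇔ with Q? []
... | yes _ = refl
... | no ¬q = ⊥-elim (¬q (Equivalence.from (Q⇔ [] refl) (Invariant.isGood inv)))
count-good (suc n) k {p} {q} {m} {d} {r} inv small Q? Q⇔ = begin
  count Q? (words k (suc n))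
    ≡⟨ count-words Q? k n ⟩
  sumBelow k g
    ≡⟨ cong (λ j → sumBelow j g) k≡ ⟨
  sumBelow (suc m + suc d + e) g
    ≡⟨ sumBelow-+ (suc m + suc d) e g ⟩
  sumBelow (suc m + suc d) g + sumBelow e (λ i → g (suc m + suc d + i))
    ≡⟨ cong₂ _+_ (sumBelow-+ (suc m) (suc d) g) (sumBelow-zero e λ i _ → reject (reject-high inv (above i))) ⟩
  sumBelow (suc m) g + sumBelow (suc d) (λ i → g (suc m + i)) + 0
    ≡⟨ ℕ.+-identityʳ _ ⟩
  sumBelow (suc m) g + sumBelow (suc d) (λ i → g (suc m + i))
    ≡⟨ cong₂ _+_ (low m inv) (sumBelow-cong (suc d) λ i i<1+d → accept (invariant-new inv (ℕ.s≤s⁻¹ i<1+d))) ⟩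
  ways p (onZero p q) d n + waysFrom p (onMax p q d) n + waysNew p d n
    ≡⟨ ℕ.+-assoc (ways p (onZero p q) d n) _ _ ⟩
  ways p q d (suc n) ∎
  where
  open ≡-Reasoning

  g : ℕ → ℕ
  g a = count (Q? ∘ (a ∷_)) (words k n)

  fits : suc m + suc d ≤ k
  fits = ℕ.≤-trans (s≤s (ℕ.≤-trans (ℕ.≤-reflexive (ℕ.+-suc m d))
    (ℕ.≤-trans (s≤s (ℕ.m≤m+n (m + d) n)) (ℕ.≤-reflexive (sym (ℕ.+-suc (m + d) n)))))) small

  e : ℕ
  e = proj₁ (ℕ.m≤n⇒∃[o]m+o≡n fits)

  k≡ : suc m + suc d + e ≡ k
  k≡ = proj₂ (ℕ.m≤n⇒∃[o]m+o≡n fits)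

  above : ∀ i → suc (m + d) < suc m + suc d + i
  above i = ℕ.≤-trans (s≤s (ℕ.≤-reflexive (sym (ℕ.+-suc m d)))) (ℕ.m≤m+n (suc m + suc d) i)

  accept : ∀ {a q′ m′ d′} → Invariant p q′ m′ d′ (a ∷ r) → g a ≡ ways p q′ d′ n
  accept {a} {q′} {m′} {d′} inv′ = count-good n k inv′ small′ (Q? ∘ (a ∷_))
    (λ w len → Q⇔ (a ∷ w) (cong suc len))
    where
    -- The sum `m + d` is the number of ascents, which one letter raises by at most one; the bound
    -- on `k` pays for this with the letter used.
    m′+d′≤ : m′ + d′ ≤ suc (m + d)
    m′+d′≤ = subst (_≤ suc (m + d)) (Invariant.ascents inv′)
      (subst (λ j → rascents (a ∷ r) ≤ suc j) (Invariant.ascents inv) (rascents-∷ a r))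

    small′ : suc (m′ + d′ + n) ≤ k
    small′ = ℕ.≤-trans (s≤s (ℕ.≤-trans (ℕ.+-monoˡ-≤ n m′+d′≤)
      (ℕ.≤-reflexive (sym (ℕ.+-suc (m + d) n))))) small

  reject : ∀ {a} → ¬ Good p (a ∷ r) → g a ≡ 0
  reject {a} bad = count-none (Q? ∘ (a ∷_)) k n
    (λ w len q → bad (suffix-good w (Equivalence.to (Q⇔ (a ∷ w) (cong suc len)) q)))

  -- While `m = 0` the phase is `closed`, so the letter 0 is counted as a zero and not a second time
  -- as the maximum.
  no-max : ∀ q → (q ≢ closed → 0 < 0) → waysFrom p (onMax p q d) n ≡ 0
  no-max fresh  pos with pos (λ ())
  ... | ()
  no-max gap    pos with pos (λ ())
  ... | ()
  no-max back   pos with pos (λ ())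
  ... | ()
  no-max closed pos = refl

  max : ∀ {m} → Invariant p q m d r → 0 < m → g m ≡ waysFrom p (onMax p q d) n
  max inv 0<m with onMax p q d in eq
  ... | just _  = accept (invariant-max inv 0<m eq)
  ... | nothing = reject (reject-max inv eq 0<m)

  low : ∀ m → Invariant p q m d r →
    sumBelow (suc m) g ≡ ways p (onZero p q) d n + waysFrom p (onMax p q d) n
  low zero    inv = cong₂ _+_ (accept (invariant-zero inv)) (sym (no-max q (Invariant.positive inv)))
  low (suc m) inv = cong₂ _+_ (accept (invariant-zero inv))
    (trans (sumBelow-last m λ i i<m → reject (reject-low inv (s≤s z≤n) (s≤s i<m))) (max inv (s≤s z≤n)))

-- The generating function of the ascent sequences

b-zero : ∀ p → b (word p) 0 ≡ 1
b-zero ⟨1001⟩ = refl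
b-zero ⟨1011⟩ = refl
b-zero ⟨1101⟩ = refl

-- The first letter must be 0. The alphabet of `n + 1` letters meets the bound of `count-good` with
-- equality at `m = d = 0`.
b-suc : ∀ p n → b (word p) (suc n) ≡ ways p closed 0 n
b-suc p n = begin
  count (B? (word p) (suc n)) (words (suc n) (suc n))
    ≡⟨ count-words (B? (word p) (suc n)) (suc n) n ⟩
  count (B? (word p) (suc n) ∘ (0 ∷_)) (words (suc n) n) +
    sumBelow n (λ a → count (B? (word p) (suc n) ∘ (suc a ∷_)) (words (suc n) n))
    ≡⟨ cong₂ _+_
         (count-good n (suc n) (invariant-start p) ℕ.≤-refl _ (B⇔good p n))
         (sumBelow-zero n λ a _ → count-none _ (suc n) n λ w _ (_ , isAsc , _) →
           ℕ.1+n≢0 (proj₁ (isAsc Fin.zero) refl)) ⟩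
  ways p closed 0 n + 0
    ≡⟨ ℕ.+-identityʳ _ ⟩
  ways p closed 0 n ∎
  where open ≡-Reasoning

f-series : ∀ p → f (word p) ≈ 𝟏 ⊕ X ⊛ continuations p
f-series p zero    = cong +_ (b-zero p)
f-series p (suc n) = begin
  + b (word p) (suc n)
    ≡⟨ cong +_ (b-suc p n) ⟩
  + ways p closed 0 n
    ≡⟨ X-⊛-suc (continuations p) n ⟨
  (X ⊛ continuations p) (suc n)
    ≡⟨ ℤ.+-identityˡ _ ⟨
  (𝟏 ⊕ X ⊛ continuations p) (suc n) ∎
  where open ≡-Reasoning

theorem2p7 : (τ : List ℕ) →
    τ ∈ (1 ∷ 0 ∷ 0 ∷ 1 ∷ []) ∷ (1 ∷ 0 ∷ 1 ∷ 1 ∷ []) ∷ (1 ∷ 1 ∷ 0 ∷ 1 ∷ []) ∷ [] →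
    ∃ λ S →
    S IsSqrtOf ((𝟏 ⊖ 3 · X ⊕ X ⊛^ 2) ⊛^ 2 ⊖ 4 · X ⊛^ 3 ⊛ (𝟏 ⊖ X)) ×
    2 · X ⊛^ 2 ⊛ f τ ≈ 𝟏 ⊖ 3 · X ⊕ 3 · X ⊛^ 2 ⊖ S
theorem2p7 _ (here refl) =
  sqrt-solution (f (word ⟨1001⟩)) (continuations ⟨1001⟩) (f-series ⟨1001⟩) (continuations-quadratic ⟨1001⟩)
theorem2p7 _ (there (here refl)) =
  sqrt-solution (f (word ⟨1011⟩)) (continuations ⟨1011⟩) (f-series ⟨1011⟩) (continuations-quadratic ⟨1011⟩)
theorem2p7 _ (there (there (here refl))) =
  sqrt-solution (f (word ⟨1101⟩)) (continuations ⟨1101⟩) (f-series ⟨1101⟩) (continuations-quadratic ⟨1101⟩)
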